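{- Let $D_S$ be an $r$-regular digraph with self-loops of order $n$ with $\sigma$ self-loops, and let $r=\lambda_1,\lambda_2,\dots,\lambda_n$ be the eigenvalues of $A(D_S)$. Define $$S_1=\left\{i\in[n]:\Re(\lambda_i)\ge\frac{\sigma}{n}\right\},$$ $$S_2^{>0}=\left\{i\in[n]:-\frac{\sigma}{n}<\Re(\lambda_i)<\frac{\sigma}{n}\text{ and }\Re(\lambda_i)+\frac{n-\sigma}{n}>0\right\},$$ $$S_2^{\le0}=\left\{i\in[n]:-\frac{\sigma}{n}<\Re(\lambda_i)<\frac{\sigma}{n}\text{ and }\Re(\lambda_i)+\frac{n-\sigma}{n}\le0\right\},$$ $$S_3^{>0}=\left\{i\in[n]:\Re(\lambda_i)\le-\frac{\sigma}{n}\text{ and }\Re(\lambda_i)+\frac{n-\sigma}{n}>0\right\},$$ $$S_3^{\le0}=\left\{i\in[n]:\Re(\lambda_i)\le-\frac{\sigma}{n}\text{ and }\Re(\lambda_i)+\frac{n-\sigma}{n}\le0\right\},$$ and let $S_2=S_2^{>0}\cup S_2^{\le0}$, $S_3=S_3^{>0}\cup S_3^{\le0}$. If $\frac n2\le\sigma\le n$, then $$E(D_S)+E(\overline{D_S})=2(n-r-1)+2\sum_{i\in S_1\cup S_2^{\le0}\cup S_3}|\Re(\lambda_i)|+\frac{2\sigma}{n}\left(|S_2^{\le0}|+|S_3|-|S_1|+1\right)-2\left(|S_2^{\le0}|+|S_3|\right).$$ If $0\le\sigma<\frac n2$, then $$E(D_S)+E(\overline{D_S})=2(n-r-1)+2\sum_{i\in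 S_1\cup S_3^{\le0}}|\Re(\lambda_i)|+\frac{2\sigma}{n}\left(|S_3^{\le0}|-|S_1|+1\right)-2|S_3^{\le0}|.$$
   Context: A digraph with self-loops $D_S$ is a pair $(V,\mathcal A)$ with $V$ a nonempty finite vertex set and $\mathcal A\subseteq V\times V$ a set of arcs; $S=\{v\in V:(v,v)\in\mathcal A\}$ is the self-loop set (possibly empty). The order is $n=|V|$ and $\sigma=|S|$; $[n]=\{1,\dots,n\}$. The adjacency matrix $A(D_S)=(a_{ij})$ has $a_{ij}=1$ if $(v_i,v_j)\in\mathcal A$ and $0$ otherwise; eigenvalues are counted with algebraic multiplicity. $D_S$ is $r$-regular if every vertex has in-degree and out-degree equal to $r$, i.e. all row sums and column sums of $A(D_S)$ equal $r$. The energy of a digraph with self-loops of order $n$ with $\sigma$ self-loops and eigenvalues $\lambda_1,\dots,\lambda_n$ is $\sum_{i=1}^n\left|\Re(\lambda_i)-\frac{\sigma}{n}\right|$ (for $\overline{D_S}$ one uses its own eigenvalues and its own number of self-loops). Put $\delta_\sigma=1$ if $\sigma=0$ and $\delta_\sigma=0$ if $\sigma\ne0$. The complement $\overline{D_S}$ is the digraph with self-loops on $V$ with adjacency matrix $A(\overline{D_S})=J_n-\delta_\sigma I_n-A(D_S)$, where $J_n$ is the all-ones matrix and $I_n$ the identity matrix. -}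

module Defs where

open import Algebra.Bundles using (CommutativeRing; RawRing)
import Algebra.Definitions.RawSemiring as RawSemiringDefinitions
open import Data.Bool.Base using (Bool; true; false; not; if_then_else_; _∧_)
open import Data.Fin.Base using (Fin; zero; suc; toℕ; punchIn)
import Data.Fin.Properties as Fin
open import Data.Fin.Subset using (Subset; _∪_; ∣_∣)
import Data.Integer.Base as ℤ
open ℤ using () renaming (+-*-rawRing to ℤ-rawRing)
open import Data.Nat.Base using (ℕ; zero; suc; _≡ᵇ_)
open import Data.Product.Base using (_×_; ∃-syntax)
open import Data.Vec.Base using (tabulate; lookup)
open import Data.Vec.Functional using (Vector)
open import Level using (Level; _⊔_) renaming (suc to lsuc)
open import Relation.Binary.Core using (Rel)
open import Relation.Binary.Definitions using (Decidable)
open import Relation.Binary.PropositionalEquality using (_≡_; refl; cong)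
open import Relation.Binary.Structures using (IsDecTotalOrder)
import Relation.Binary.Construct.NonStrictToStrict as ToStrict
open import Relation.Nullary using (yes; no)
open import Relation.Nullary.Decidable using (does; _×-dec_)
import Relation.Unary as U

private
  variable
    c ℓ ℓ₁ ℓ₂ p : Level
    n : ℕ

------------------------------------------------------------------------
-- Finite sets of indices

select : {P : U.Pred (Fin n) p} → U.Decidable P → Subset n
select P? = tabulate (λ i → does (P? i))

------------------------------------------------------------------------
-- Digraphs with self-loops

-- The vertices are numbered, V = {v₁, …, vₙ}, as is needed anyway to speak
-- of the adjacency matrix.

record Digraph (n : ℕ) : Set where
  field
    arc : Fin n → Fin n → Bool

  selfLoops : Subset n
  selfLoops = tabulate (λ v → arc v v)

  σ : ℕ
  σ = ∣ selfLoops ∣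

  outDegree inDegree : Fin n → ℕ
  outDegree v = ∣ tabulate (λ w → arc v w) ∣
  inDegree  v = ∣ tabulate (λ u → arc u v) ∣

open Digraph

Regular : ℕ → Digraph n → Set
Regular r D = ∀ v → (outDegree D v ≡ r) × (inDegree D v ≡ r)

-- The matrix form J − δ_σ I − A of this definition is `complement-adjacency`
-- below.

complement : Digraph n → Digraph n
complement D .arc u v =
  not (arc D u v) ∧ not ((σ D ≡ᵇ 0) ∧ does (u Fin.≟ v))

------------------------------------------------------------------------
-- Matrices

module Matrices (R : RawRing c ℓ) where
  open RawRing R
  open RawSemiringDefinitions rawSemiring using (sum; _^_)

  Matrix : ℕ → Set c
  Matrix n = Vector (Vector Carrier n) n

  identity : Matrix n
  identity i j = if does (i Fin.≟ j) then 1# else 0#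

  adjacency : Digraph n → Matrix n
  adjacency D i j = if arc D i j then 1# else 0#

  -- Laplace expansion along the first row.
  det : Matrix n → Carrier
  det {zero}  M = 1#
  det {suc n} M = sum λ j →
    (- 1#) ^ toℕ j * (M zero j * det (λ i k → M (suc i) (punchIn j k)))

δ : ℕ → ℤ.ℤ
δ zero    = ℤ.1ℤ
δ (suc _) = ℤ.0ℤ

private
  module ℤM = Matrices ℤ-rawRing

  no-selfLoop : (b : Fin n → Bool) → ∣ tabulate b ∣ ≡ 0 → ∀ i → b i ≡ false
  no-selfLoop {suc n} b eq i with b zero in b₀
  no-selfLoop {suc n} b () i       | true
  no-selfLoop {suc n} b eq zero    | false = b₀
  no-selfLoop {suc n} b eq (suc i) | false = no-selfLoop (λ j → b (suc j)) eq i

complement-adjacency : (D : Digraph n) → ∀ i j →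
  ℤM.adjacency (complement D) i j ≡
  ℤ.1ℤ ℤ.- δ (σ D) ℤ.* ℤM.identity i j ℤ.- ℤM.adjacency D i j
complement-adjacency D i j with σ D in eq | i Fin.≟ j
... | zero  | yes refl rewrite no-selfLoop (λ v → arc D v v) eq i = refl
... | zero  | no _ with arc D i j
...   | true  = refl
...   | false = refl
complement-adjacency D i j | suc _ | _ with arc D i j
...   | true  = refl
...   | false = refl

------------------------------------------------------------------------
-- The real numbers

-- The library has no real numbers, so they are axiomatised as a
-- Dedekind-complete totally ordered field, which is unique up to
-- isomorphism.  The order is decidable, as it is classically: without this
-- the index sets below would not be subsets with a cardinality.  The value
-- of 0# ⁻¹ is unspecified.

record Reals c ℓ₁ ℓ₂ : Set (lsuc (c ⊔ ℓ₁ ⊔ ℓ₂)) where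
  field
    commutativeRing : CommutativeRing c ℓ₁

  open CommutativeRing commutativeRing public

  infix 4 _≤_
  infix 9 _⁻¹

  field
    _≤_             : Rel Carrier ℓ₂
    isDecTotalOrder : IsDecTotalOrder _≈_ _≤_
    +-monoˡ-≤       : ∀ z {x y} → x ≤ y → x + z ≤ y + z
    *-nonNegative   : ∀ {x y} → 0# ≤ x → 0# ≤ y → 0# ≤ x * y
    0≉1             : 0# ≉ 1#
    _⁻¹             : Carrier → Carrier
    ⁻¹-cong         : ∀ {x y} → x ≈ y → x ⁻¹ ≈ y ⁻¹
    ⁻¹-inverseʳ     : ∀ {x} → x ≉ 0# → x * x ⁻¹ ≈ 1#

  UpperBound : U.Pred Carrier p → Carrier → Set (c ⊔ ℓ₂ ⊔ p)
  UpperBound P b = ∀ {x} → P x → x ≤ b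

  field
    complete : (P : U.Pred Carrier (c ⊔ ℓ₁ ⊔ ℓ₂)) →
               ∃[ x ] P x → ∃[ b ] UpperBound P b →
               ∃[ s ] (UpperBound P s × (∀ {b} → UpperBound P b → s ≤ b))

  open IsDecTotalOrder isDecTotalOrder public using (_≟_; _≤?_)
  open ToStrict _≈_ _≤_ public using (_<_)
  open RawSemiringDefinitions (RawRing.rawSemiring rawRing) public
    using (sum) renaming (_×_ to _×ℕ_)

  infix 4 _<?_
  _<?_ : Decidable _<_
  _<?_ = ToStrict.<-decidable _≈_ _≤_ _≟_ _≤?_

  infixl 7 _/_
  _/_ : Carrier → Carrier → Carrier
  x / y = x * y ⁻¹

  fromℕ : ℕ → Carrier
  fromℕ k = k ×ℕ 1#

  abs : Carrier → Carrier
  abs x = if does (0# ≤? x) then x else - x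

  card : Subset n → Carrier
  card S = fromℕ ∣ S ∣

  sumOver : Subset n → Vector Carrier n → Carrier
  sumOver S f = sum (λ i → if lookup S i then f i else 0#)

------------------------------------------------------------------------
-- Complex numbers, spectra and energy

module Spectral (ℝ : Reals c ℓ₁ ℓ₂) where
  open Reals ℝ public

  record ℂ : Set c where
    constructor _+i_
    field
      re im : Carrier

  open ℂ public

  ℂ-rawRing : RawRing c ℓ₁
  ℂ-rawRing = record
    { Carrier = ℂ
    ; _≈_     = λ z w → (re z ≈ re w) × (im z ≈ im w)
    ; _+_     = λ z w → (re z + re w) +i (im z + im w)
    ; _*_     = λ z w → (re z * re w - im z * im w) +i
                        (re z * im w + im z * re w)
    ; -_      = λ z → (- re z) +i (- im z)
    ; 0#      = 0# +i 0#
    ; 1#      = 1# +i 0#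
    }

  private
    module C where
      open RawRing ℂ-rawRing public
      open RawSemiringDefinitions rawSemiring public using (product)

  open Matrices ℂ-rawRing

  infix 4 _≈ℂ_
  _≈ℂ_ : Rel ℂ ℓ₁
  _≈ℂ_ = C._≈_

  fromℝ : Carrier → ℂ
  fromℝ x = x +i 0#

  charPoly : Matrix n → ℂ → ℂ
  charPoly A z = det (λ i j → z C.* identity i j C.+ C.- A i j)

  -- ev lists the eigenvalues of A with algebraic multiplicity:
  -- det (zI − A) = ∏ᵢ (z − evᵢ).  Since ℂ is infinite, this identity of
  -- polynomials in z may be read as an identity of functions.
  IsSpectrum : Matrix n → Vector ℂ n → Set (c ⊔ ℓ₁)
  IsSpectrum A ev = ∀ z → charPoly A z ≈ℂ C.product (λ i → z C.+ C.- ev i)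

  IsDigraphSpectrum : Digraph n → Vector ℂ n → Set (c ⊔ ℓ₁)
  IsDigraphSpectrum D = IsSpectrum (adjacency D)

  σ/n : Digraph n → Carrier
  σ/n {n} D = fromℕ (σ D) / fromℕ n

  -- The energy of D, where ev lists the eigenvalues of D.
  energy : Digraph n → Vector ℂ n → Carrier
  energy D ev = sum (λ i → abs (re (ev i) - σ/n D))

  module IndexSets (D : Digraph n) (ev : Vector ℂ n) where
    s t : Carrier
    s = σ/n D
    t = (fromℕ n - fromℕ (σ D)) / fromℕ n

    x : Fin n → Carrier
    x i = re (ev i)

    S₁ S₂⁺ S₂⁻ S₃⁺ S₃⁻ S₂ S₃ : Subset n
    S₁  = select λ i → s ≤? x i
    S₂⁺ = select λ i → ((- s <? x i) ×-dec (x i <? s)) ×-dec (0# <? x i + t)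
    S₂⁻ = select λ i → ((- s <? x i) ×-dec (x i <? s)) ×-dec (x i + t ≤? 0#)
    S₃⁺ = select λ i → (x i ≤? - s) ×-dec (0# <? x i + t)
    S₃⁻ = select λ i → (x i ≤? - s) ×-dec (x i + t ≤? 0#)
    S₂  = S₂⁺ ∪ S₂⁻
    S₃  = S₃⁺ ∪ S₃⁻

{-# OPTIONS --safe #-}
module Submission where

-- Put δ = δ_σ, s = σ/n and t = (n − σ)/n.  Column operations on a matrix B with
-- constant row sums ρ give ρ · det (B − J) = (ρ − n) · det B.  For the matrices
-- of the two characteristic polynomials this says that, as multisets,
-- {− δ − r} ∪ spec D̄ = {n − δ − r} ∪ {− δ − λᵢ}: two products of linear factors
-- that agree as functions have the same roots, since equal factors can be
-- cancelled over a domain of characteristic zero.  As D̄ has σ̄/n = t − δ,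
--
--   E(D) + E(D̄) = ∑ᵢ (∣xᵢ − s∣ + ∣xᵢ + t∣) + (n − r − t) − (r + t),  xᵢ = Re λᵢ,
--
-- and the summand is linear on each of x ≥ s, − t ≤ x ≤ s and x ≤ − t.  Which
-- of the index sets make up the last range depends on whether t ≤ s.

open import Defs
open import Algebra.Bundles using (CommutativeRing; CommutativeMonoid; RawRing)
import Algebra.Definitions.RawSemiring as RawSemiringDefinitions
import Algebra.Properties.CommutativeMonoid.Sum as MonoidSum
import Algebra.Properties.Semiring.Sum as SemiringSum
import Algebra.Properties.Semiring.Mult as SemiringMult
import Algebra.Properties.Semiring.Mult.TCOptimised as OptimisedMult
import Algebra.Properties.Ring as RingProperties
import Algebra.Solver.Ring as Solver
open import Algebra.Solver.Ring.AlmostCommutativeRing using (fromCommutativeRing; _-Raw-AlmostCommutative⟶_)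
open import Data.Bool.Base using (Bool; true; false; not; if_then_else_; _∨_)
open import Data.Empty using (⊥; ⊥-elim)
open import Data.Fin.Base as Fin using (Fin; zero; suc; toℕ; inject₁; fromℕ<; punchIn; punchOut)
open import Data.Fin.Induction using (<-weakInduction)
import Data.Fin.Properties as Fin
open import Data.Fin.Subset using (Subset; _∪_; ∣_∣)
open import Data.Integer.Base as ℤ using (ℤ; +_; -[1+_]; 1ℤ; 0ℤ) renaming (+-*-rawRing to ℤ-rawRing)
import Data.Integer.Properties as ℤ
open import Data.Maybe.Base using (Maybe; just; nothing)
open import Data.Nat.Base as ℕ using (ℕ; zero; suc)
import Data.Nat.Properties as ℕ
open import Data.Product.Base using (_×_; _,_; proj₁; proj₂; ∃-syntax)
open import Data.Sum.Base using (_⊎_; inj₁; inj₂; [_,_]′)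
open import Data.Vec.Base as Vec using (tabulate; lookup)
open import Data.Vec.Functional using (Vector; _∷_; tail; updateAt; removeAt)
import Data.Vec.Functional.Properties as Vector
import Data.Vec.Properties as Vec
open import Function.Base using (_∘_; const; _$_)
open import Level using (Level; _⊔_)
open import Relation.Binary.PropositionalEquality as ≡ using (_≡_; _≢_)
open import Relation.Binary.Definitions using (tri<; tri≈; tri>)
open import Relation.Binary.Structures using (IsDecTotalOrder)
import Relation.Binary.Reasoning.Setoid as SetoidReasoning
open import Relation.Nullary using (¬_; Dec; yes; no; contradiction)
open import Relation.Nullary.Decidable using (does; dec-true; dec-false; _×-dec_)

-- The factor `ρ = z + δ + r` vanishes at `z = - δ - r`, so the determinant identity is never
-- divided by it. Its root stays as an extra member beside the spectrum of the complement, and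
-- `n - δ - r` on the other side is the root of `ρ - n`. Under x ↦ ∣x - (t - δ)∣ these two members
-- give `r + t` and `n - r - t`. Their signs rest on `0 ≤ t` and `t ≤ n - r`; the second holds
-- because a vertex without a loop is a non-arc of its own row, and every row has `n - r` non-arcs.
--
-- Spectra are given as identities of functions, so multiplicities have to be recovered from values
-- alone: at `a` itself the factor `x - a` says nothing about its cofactor. Polynomials are
-- therefore handled as functions with a degree bound, and equality of multisets enters only as
-- equality of the sums of an arbitrary function over the roots.
--
-- The determinant is known only through its expansion along the first row. The column rules are
-- derived from that; the hard one is the vanishing for two equal columns that are not adjacent.

private
  variable
    ℓ : Level
    n : ℕ

-- Integer coefficients for the ring solver.

module RingSolver {c ℓ : Level} (R : CommutativeRing c ℓ) where
  open CommutativeRing R hiding (zero)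
  open RingProperties ring using (-0#≈0#; -‿involutive; -‿+-comm; -‿distribˡ-*; -‿distribʳ-*)
  open OptimisedMult semiring using (1+×; ×-homo-+; ×1-homo-*) renaming (_×_ to _×′_)
  open SetoidReasoning setoid

  -- Built on the multiplication for which `1 ×′ x` is `x` by definition, so that `0ℤ` and `1ℤ`
  -- denote `0#` and `1#` by computation. Hence the `refl`s in `morphism`, and `:0` and `:1` match
  -- the constants of a goal directly.
  ⟦_⟧ℤ : ℤ → Carrier
  ⟦ + k ⟧ℤ      = k ×′ 1#
  ⟦ -[1+ k ] ⟧ℤ = - (suc k ×′ 1#)

  ⟦⟧-⊖ : ∀ k l → ⟦ k ℤ.⊖ l ⟧ℤ ≈ k ×′ 1# - l ×′ 1#
  ⟦⟧-⊖ k       zero    = sym (trans (+-congˡ -0#≈0#) (+-identityʳ _))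
  ⟦⟧-⊖ zero    (suc l) = sym (+-identityˡ _)
  ⟦⟧-⊖ (suc k) (suc l) = begin
    ⟦ suc k ℤ.⊖ suc l ⟧ℤ                   ≡⟨ ≡.cong ⟦_⟧ℤ (ℤ.[1+m]⊖[1+n]≡m⊖n k l) ⟩
    ⟦ k ℤ.⊖ l ⟧ℤ                           ≈⟨ ⟦⟧-⊖ k l ⟩
    k ×′ 1# - l ×′ 1#                      ≈⟨ +-congʳ (+-identityʳ _) ⟨
    k ×′ 1# + 0# - l ×′ 1#                 ≈⟨ +-congʳ (+-congˡ (-‿inverseʳ 1#)) ⟨
    k ×′ 1# + (1# - 1#) - l ×′ 1#          ≈⟨ +-congʳ (+-assoc _ _ _) ⟨
    k ×′ 1# + 1# - 1# - l ×′ 1#            ≈⟨ +-assoc _ _ _ ⟩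
    k ×′ 1# + 1# + (- 1# - l ×′ 1#)        ≈⟨ +-cong (+-comm _ _) (-‿+-comm 1# _) ⟩
    1# + k ×′ 1# - (1# + l ×′ 1#)          ≈⟨ +-cong (1+× k 1#) (-‿cong (1+× l 1#)) ⟨
    suc k ×′ 1# - suc l ×′ 1#              ∎

  ⟦⟧-neg : ∀ x → ⟦ ℤ.- x ⟧ℤ ≈ - ⟦ x ⟧ℤ
  ⟦⟧-neg (+ zero)  = sym -0#≈0#
  ⟦⟧-neg (+ suc k) = refl
  ⟦⟧-neg -[1+ k ]  = sym (-‿involutive _)

  ⟦⟧-+ : ∀ x y → ⟦ x ℤ.+ y ⟧ℤ ≈ ⟦ x ⟧ℤ + ⟦ y ⟧ℤ
  ⟦⟧-+ (+ k)    (+ l)    = ×-homo-+ 1# k l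
  ⟦⟧-+ (+ k)    -[1+ l ] = ⟦⟧-⊖ k (suc l)
  ⟦⟧-+ -[1+ k ] (+ l)    = trans (⟦⟧-⊖ l (suc k)) (+-comm _ _)
  ⟦⟧-+ -[1+ k ] -[1+ l ] = begin
    - (suc (suc (k ℕ.+ l)) ×′ 1#)          ≡⟨ ≡.cong (λ m → - (m ×′ 1#)) (≡.cong suc (ℕ.+-suc k l)) ⟨
    - ((suc k ℕ.+ suc l) ×′ 1#)            ≈⟨ -‿cong (×-homo-+ 1# (suc k) (suc l)) ⟩
    - (suc k ×′ 1# + suc l ×′ 1#)          ≈⟨ -‿+-comm _ _ ⟨
    - (suc k ×′ 1#) - suc l ×′ 1#          ∎

  ⟦⟧-*⁺ : ∀ k y → ⟦ + k ℤ.* y ⟧ℤ ≈ k ×′ 1# * ⟦ y ⟧ℤ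
  ⟦⟧-*⁺ k (+ l) = trans (reflexive (≡.cong ⟦_⟧ℤ (≡.sym (ℤ.pos-* k l)))) (×1-homo-* k l)
  ⟦⟧-*⁺ k -[1+ l ] = begin
    ⟦ + k ℤ.* ℤ.- (+ suc l) ⟧ℤ             ≡⟨ ≡.cong ⟦_⟧ℤ (ℤ.neg-distribʳ-* (+ k) (+ suc l)) ⟨
    ⟦ ℤ.- (+ k ℤ.* + suc l) ⟧ℤ             ≈⟨ ⟦⟧-neg (+ k ℤ.* + suc l) ⟩
    - ⟦ + k ℤ.* + suc l ⟧ℤ                 ≈⟨ -‿cong (⟦⟧-*⁺ k (+ suc l)) ⟩
    - (k ×′ 1# * suc l ×′ 1#)              ≈⟨ -‿distribʳ-* _ _ ⟩
    k ×′ 1# * - (suc l ×′ 1#)              ∎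

  ⟦⟧-* : ∀ x y → ⟦ x ℤ.* y ⟧ℤ ≈ ⟦ x ⟧ℤ * ⟦ y ⟧ℤ
  ⟦⟧-* (+ k)    y = ⟦⟧-*⁺ k y
  ⟦⟧-* -[1+ k ] y = begin
    ⟦ ℤ.- (+ suc k) ℤ.* y ⟧ℤ               ≡⟨ ≡.cong ⟦_⟧ℤ (ℤ.neg-distribˡ-* (+ suc k) y) ⟨
    ⟦ ℤ.- (+ suc k ℤ.* y) ⟧ℤ               ≈⟨ ⟦⟧-neg (+ suc k ℤ.* y) ⟩
    - ⟦ + suc k ℤ.* y ⟧ℤ                   ≈⟨ -‿cong (⟦⟧-*⁺ (suc k) y) ⟩
    - (suc k ×′ 1# * ⟦ y ⟧ℤ)               ≈⟨ -‿distribˡ-* _ _ ⟩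
    - (suc k ×′ 1#) * ⟦ y ⟧ℤ               ∎

  morphism : ℤ-rawRing -Raw-AlmostCommutative⟶ fromCommutativeRing R
  morphism = record
    { ⟦_⟧    = ⟦_⟧ℤ
    ; +-homo = ⟦⟧-+
    ; *-homo = ⟦⟧-*
    ; -‿homo = ⟦⟧-neg
    ; 0-homo = refl
    ; 1-homo = refl
    }

  ⟦⟧-weaklyDecidable : ∀ x y → Maybe (⟦ x ⟧ℤ ≈ ⟦ y ⟧ℤ)
  ⟦⟧-weaklyDecidable x y with x ℤ.≟ y
  ... | yes x≡y = just (reflexive (≡.cong ⟦_⟧ℤ x≡y))
  ... | no  _   = nothing

  open Solver ℤ-rawRing (fromCommutativeRing R) morphism ⟦⟧-weaklyDecidable public
    using (solve; _:=_; con; _:+_; _:*_; _:-_; :-_; Polynomial)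

  :0 :1 :2 : Polynomial n
  :0 = con 0ℤ
  :1 = con 1ℤ
  -- denotes fromℕ 2, which unfolds to 1# + (1# + 0#)
  :2 = :1 :+ (:1 :+ :0)

-- Determinants: linearity in a column.

module Determinants {c ℓ : Level} (R : CommutativeRing c ℓ) where
  open CommutativeRing R hiding (zero)
  open RingSolver R
  open Matrices rawRing
  open SemiringSum semiring using (sum; sum-cong-≋; ∑-distrib-+; *-distribˡ-sum; sum-replicate-zero)
  open SemiringMult semiring using () renaming (_×_ to _×ℕ_)
  open RawSemiringDefinitions (RawRing.rawSemiring rawRing) using (_^_)
  open SetoidReasoning setoid

  minor : Matrix (suc n) → Fin (suc n) → Matrix n
  minor M j i k = M (suc i) (punchIn j k)

  det-cong : {M N : Matrix n} → (∀ i j → M i j ≈ N i j) → det M ≈ det N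
  det-cong {zero}  eq = refl
  det-cong {suc n} eq = sum-cong-≋ λ j →
    *-congˡ {x = (- 1#) ^ toℕ j} (*-cong (eq zero j) (det-cong λ i k → eq (suc i) (punchIn j k)))

  -- In the term of column `k` the entry carries the combination, and the three minors agree because
  -- they omit that column. In every other term the entry is shared and the minor still contains
  -- column `k`, so induction applies to it.
  det-linear : (k : Fin n) (a b : Carrier) {M N P : Matrix n} →
               (∀ i {j} → j ≢ k → P i j ≈ M i j) →
               (∀ i {j} → j ≢ k → P i j ≈ N i j) →
               (∀ i → P i k ≈ a * M i k + b * N i k) →
               det P ≈ a * det M + b * det N
  det-linear {suc n} k a b {M} {N} {P} P≈M P≈N Pk = begin
    sum (term P)                                          ≈⟨ sum-cong-≋ term-linear ⟩
    sum (λ j → a * term M j + b * term N j)               ≈⟨ ∑-distrib-+ (λ j → a * term M j) (λ j → b * term N j) ⟩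
    sum (λ j → a * term M j) + sum (λ j → b * term N j)   ≈⟨ +-cong (*-distribˡ-sum a (term M)) (*-distribˡ-sum b (term N)) ⟨
    a * sum (term M) + b * sum (term N)                   ∎
    where
    term : Matrix (suc n) → Fin (suc n) → Carrier
    term M j = (- 1#) ^ toℕ j * (M zero j * det (minor M j))

    term-linear : ∀ j → term P j ≈ a * term M j + b * term N j
    term-linear j with j Fin.≟ k
    ... | yes ≡.refl = begin
      s * (P zero j * det (minor P j))
        ≈⟨ *-congˡ {x = s} (*-cong (Pk zero) minorP≈M) ⟩
      s * ((a * M zero j + b * N zero j) * det (minor M j))
        ≈⟨ solve 6 (λ s a b x y d → s :* ((a :* x :+ b :* y) :* d) := a :* (s :* (x :* d)) :+ b :* (s :* (y :* d))) refl s a b (M zero j) (N zero j) (det (minor M j)) ⟩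
      a * term M j + b * (s * (N zero j * det (minor M j)))
        ≈⟨ +-congˡ (*-congˡ {x = b} (*-congˡ {x = s} (*-congˡ (trans (sym minorP≈M) minorP≈N)))) ⟩
      a * term M j + b * term N j ∎
      where
      s = (- 1#) ^ toℕ j
      minorP≈M : det (minor P j) ≈ det (minor M j)
      minorP≈M = det-cong λ i l → P≈M (suc i) (Fin.punchInᵢ≢i j l)
      minorP≈N : det (minor P j) ≈ det (minor N j)
      minorP≈N = det-cong λ i l → P≈N (suc i) (Fin.punchInᵢ≢i j l)
    ... | no j≢k = begin
      s * (P zero j * det (minor P j))
        ≈⟨ *-congˡ {x = s} (*-congˡ minor-linear) ⟩
      s * (P zero j * (a * det (minor M j) + b * det (minor N j)))
        ≈⟨ solve 6 (λ s p a b d e → s :* (p :* (a :* d :+ b :* e)) := a :* (s :* (p :* d)) :+ b :* (s :* (p :* e))) refl s (P zero j) a b (det (minor M j)) (det (minor N j)) ⟩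
      a * (s * (P zero j * det (minor M j))) + b * (s * (P zero j * det (minor N j)))
        ≈⟨ +-cong (*-congˡ {x = a} (*-congˡ {x = s} (*-congʳ (P≈M zero j≢k)))) (*-congˡ {x = b} (*-congˡ {x = s} (*-congʳ (P≈N zero j≢k)))) ⟩
      a * term M j + b * term N j ∎
      where
      s = (- 1#) ^ toℕ j
      -- The position of column `k` in the minor that omits column `j`.
      k′ = punchOut j≢k
      punchIn-k′ : punchIn j k′ ≡ k
      punchIn-k′ = Fin.punchIn-punchOut j≢k
      off : ∀ {l} → l ≢ k′ → punchIn j l ≢ k
      off l≢k′ eq = l≢k′ (Fin.punchIn-injective j _ _ (≡.trans eq (≡.sym punchIn-k′)))
      minor-linear : det (minor P j) ≈ a * det (minor M j) + b * det (minor N j)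
      minor-linear = det-linear k′ a b
        (λ i l≢k′ → P≈M (suc i) (off l≢k′))
        (λ i l≢k′ → P≈N (suc i) (off l≢k′))
        (λ i → ≡.subst (λ l → P (suc i) l ≈ a * M (suc i) l + b * N (suc i) l) (≡.sym punchIn-k′) (Pk (suc i)))

  -- Determinants with two equal columns.

  sum-zero : {f : Vector Carrier n} → (∀ j → f j ≈ 0#) → sum f ≈ 0#
  sum-zero {n} f≈0 = trans (sum-cong-≋ f≈0) (sum-replicate-zero n)

  sum-adjacent : (i : Fin n) {f : Vector Carrier (suc n)} →
                 f (inject₁ i) + f (suc i) ≈ 0# →
                 (∀ {j} → j ≢ inject₁ i → j ≢ suc i → f j ≈ 0#) → sum f ≈ 0#
  sum-adjacent zero {f} pair≈0 rest≈0 = begin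
    f zero + (f (suc zero) + sum (tail (tail f))) ≈⟨ +-assoc _ _ _ ⟨
    f zero + f (suc zero) + sum (tail (tail f))   ≈⟨ +-cong pair≈0 (sum-zero {f = tail (tail f)} λ j → rest≈0 (λ ()) (λ ())) ⟩
    0# + 0#                                       ≈⟨ +-identityˡ 0# ⟩
    0#                                            ∎
  sum-adjacent (suc i) {f} pair≈0 rest≈0 = begin
    f zero + sum (tail f)   ≈⟨ +-cong (rest≈0 (λ ()) (λ ())) (sum-adjacent i {tail f} pair≈0 (λ p q → rest≈0 (p ∘ Fin.suc-injective) (q ∘ Fin.suc-injective))) ⟩
    0# + 0#                 ≈⟨ +-identityˡ 0# ⟩
    0#                      ∎

  -- Lets `alternating-adjacent` call itself on a minor: when a third column is omitted, two
  -- neighbours remain neighbours.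
  punchIn-adjacent : (i : Fin (suc n)) {j : Fin (suc (suc n))} → j ≢ inject₁ i → j ≢ suc i →
                     ∃[ i′ ] (punchIn j (inject₁ i′) ≡ inject₁ i × punchIn j (suc i′) ≡ suc i)
  punchIn-adjacent zero    {zero}        j≢i j≢1+i = contradiction ≡.refl j≢i
  punchIn-adjacent zero    {suc zero}    j≢i j≢1+i = contradiction ≡.refl j≢1+i
  punchIn-adjacent {suc n} zero    {suc (suc j)} j≢i j≢1+i = zero , ≡.refl , ≡.refl
  punchIn-adjacent {suc n} (suc i) {zero}  j≢i j≢1+i = i , ≡.refl , ≡.refl
  punchIn-adjacent {suc n} (suc i) {suc j} j≢i j≢1+i =
    let i′ , eq , eq′ = punchIn-adjacent i (j≢i ∘ ≡.cong suc) (j≢1+i ∘ ≡.cong suc)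
    in suc i′ , ≡.cong suc eq , ≡.cong suc eq′

  -- Compares the minors that omit one or the other of two neighbouring columns. They differ only
  -- where each keeps the column that the other omits, and there equal columns make the entries
  -- agree.
  punchIn-neighbours : (i l : Fin n) →
    (punchIn (inject₁ i) l ≡ punchIn (suc i) l) ⊎
    (punchIn (inject₁ i) l ≡ suc i × punchIn (suc i) l ≡ inject₁ i)
  punchIn-neighbours zero    zero    = inj₂ (≡.refl , ≡.refl)
  punchIn-neighbours zero    (suc l) = inj₁ ≡.refl
  punchIn-neighbours (suc i) zero    = inj₁ ≡.refl
  punchIn-neighbours (suc i) (suc l) with punchIn-neighbours i l
  ... | inj₁ eq         = inj₁ (≡.cong suc eq)
  ... | inj₂ (eq , eq′) = inj₂ (≡.cong suc eq , ≡.cong suc eq′)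

  Alternating : (j k : Fin n) → Set (c ⊔ ℓ)
  Alternating {n} j k = (M : Matrix n) → (∀ i → M i j ≈ M i k) → det M ≈ 0#

  -- The two terms at the equal columns have the same minor and opposite signs; all other minors
  -- again have two adjacent equal columns and vanish by induction. For columns further apart the
  -- two minors would differ by a permutation, which is why adjacency comes first.
  alternating-adjacent : (k : Fin n) → Alternating (inject₁ k) (suc k)
  alternating-adjacent {suc n} k M M≈ = sum-adjacent k pair rest
    where
    term : Fin (suc (suc n)) → Carrier
    term j = (- 1#) ^ toℕ j * (M zero j * det (minor M j))

    minors≈ : ∀ i l → minor M (inject₁ k) i l ≈ minor M (suc k) i l
    minors≈ i l with punchIn-neighbours k l
    ... | inj₁ eq         = reflexive (≡.cong (M (suc i)) eq)
    ... | inj₂ (eq , eq′) = begin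
      M (suc i) (punchIn (inject₁ k) l)  ≡⟨ ≡.cong (M (suc i)) eq ⟩
      M (suc i) (suc k)                  ≈⟨ M≈ (suc i) ⟨
      M (suc i) (inject₁ k)              ≡⟨ ≡.cong (M (suc i)) eq′ ⟨
      M (suc i) (punchIn (suc k) l)      ∎

    pair : term (inject₁ k) + term (suc k) ≈ 0#
    pair = begin
      term (inject₁ k) + term (suc k)
        -- `toℕ (inject₁ k)` is `toℕ k`, so the two signs differ by one factor `- 1#`.
        ≈⟨ +-congʳ (*-cong (reflexive (≡.cong ((- 1#) ^_) (Fin.toℕ-inject₁ k))) (*-cong (M≈ zero) (det-cong minors≈))) ⟩
      s * (x * d) + - 1# * s * (x * d)
        ≈⟨ solve 3 (λ s x d → s :* (x :* d) :+ :- :1 :* s :* (x :* d) := :0) refl s x d ⟩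
      0# ∎
      where
      s = (- 1#) ^ toℕ k
      x = M zero (suc k)
      d = det (minor M (suc k))

    rest : ∀ {j} → j ≢ inject₁ k → j ≢ suc k → term j ≈ 0#
    rest {j} j≢k j≢1+k =
      let k′ , eq , eq′ = punchIn-adjacent k j≢k j≢1+k
          minor≈ i = ≡.subst₂ (λ l l′ → M (suc i) l ≈ M (suc i) l′) (≡.sym eq) (≡.sym eq′) (M≈ (suc i))
      in trans (*-congˡ {x = (- 1#) ^ toℕ j}
                 (trans (*-congˡ {x = M zero j} (alternating-adjacent k′ (minor M j) minor≈)) (zeroʳ _)))
               (zeroʳ _)

  alternating-sym : {j k : Fin n} → Alternating j k → Alternating k j
  alternating-sym alt M M≈ = alt M (sym ∘ M≈)

  -- Sealed, so that later proofs see a replaced column only through the two equations below and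
  -- never through an unfolded `updateAt`.
  opaque
    replaceColumn : Matrix n → Fin n → (Fin n → Carrier) → Matrix n
    replaceColumn M k v i = updateAt (M i) k (const (v i))

    replaceColumn-at : (M : Matrix n) (k : Fin n) (v : Fin n → Carrier) → ∀ i → replaceColumn M k v i k ≡ v i
    replaceColumn-at M k v i = Vector.updateAt-updates k (M i)

    replaceColumn-off : (M : Matrix n) (k : Fin n) (v : Fin n → Carrier) →
                        ∀ i {j} → j ≢ k → replaceColumn M k v i j ≡ M i j
    replaceColumn-off M k v i {j} j≢k = Vector.updateAt-minimal j k (M i) j≢k

  -- By linearity in column `k`, `det P` is `det M` plus `a` times the determinant of `N`, where
  -- column `j` has been copied into column `k`; the latter vanishes.
  det-addColumn : {j k : Fin n} → j ≢ k → Alternating j k → (a : Carrier) {M P : Matrix n} →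
                  (∀ i {l} → l ≢ k → P i l ≈ M i l) →
                  (∀ i → P i k ≈ M i k + a * M i j) →
                  det P ≈ det M
  det-addColumn {n} {j} {k} j≢k alt a {M} {P} P≈M Pk = begin
    det P                     ≈⟨ det-linear k 1# a P≈M
                                   (λ i l≢k → trans (P≈M i l≢k) (sym (N-off i l≢k)))
                                   (λ i → trans (Pk i) (+-cong (sym (*-identityˡ _)) (*-congˡ (sym (N-at i))))) ⟩
    1# * det M + a * det N    ≈⟨ +-cong (*-identityˡ _) (*-congˡ (alt N (λ i → trans (N-off i j≢k) (sym (N-at i))))) ⟩
    det M + a * 0#            ≈⟨ +-congˡ (zeroʳ a) ⟩
    det M + 0#                ≈⟨ +-identityʳ _ ⟩
    det M                     ∎
    where
    N : Matrix n
    N = replaceColumn M k (λ i → M i j)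
    N-at : ∀ i → N i k ≈ M i j
    N-at i = reflexive (replaceColumn-at M k _ i)
    N-off : ∀ i {l} → l ≢ k → N i l ≈ M i l
    N-off i l≢k = reflexive (replaceColumn-off M k _ i l≢k)

  -- Three additions of adjacent columns turn (x, …, y, x) into (x, …, x, − y).
  alternating-step : (k : Fin n) {j : Fin (suc n)} → j ≢ inject₁ k → j ≢ suc k →
                     Alternating j (inject₁ k) → Alternating j (suc k)
  alternating-step {n} k {j} j≢k j≢1+k alt M M≈ = begin
    det M    ≈⟨ det-addColumn 1+k≢k (alternating-sym (alternating-adjacent k)) 1# (λ i → off M k₀ v₁ i) (λ i → at M k₀ v₁ i) ⟨
    det M₁   ≈⟨ det-addColumn (1+k≢k ∘ ≡.sym) (alternating-adjacent k) (- 1#) (λ i → off M₁ k₁ v₂ i) (λ i → at M₁ k₁ v₂ i) ⟨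
    det M₂   ≈⟨ det-addColumn 1+k≢k (alternating-sym (alternating-adjacent k)) 1# (λ i → off M₂ k₀ v₃ i) (λ i → at M₂ k₀ v₃ i) ⟨
    det M₃   ≈⟨ alt M₃ M₃≈ ⟩
    0#       ∎
    where
    k₀ k₁ : Fin (suc n)
    k₀ = inject₁ k
    k₁ = suc k
    1+k≢k : k₁ ≢ k₀
    1+k≢k eq = ℕ.1+n≢n (≡.trans (≡.cong toℕ eq) (Fin.toℕ-inject₁ k))
    at : (M : Matrix (suc n)) (k : Fin (suc n)) (v : Fin (suc n) → Carrier) → ∀ i → replaceColumn M k v i k ≈ v i
    at M k v i = reflexive (replaceColumn-at M k v i)
    off : (M : Matrix (suc n)) (k : Fin (suc n)) (v : Fin (suc n) → Carrier) →
          ∀ i {j} → j ≢ k → replaceColumn M k v i j ≈ M i j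
    off M k v i j≢k = reflexive (replaceColumn-off M k v i j≢k)
    M₁ M₂ M₃ : Matrix (suc n)
    v₁ v₂ v₃ : Fin (suc n) → Carrier
    v₁ i = M i k₀ + 1# * M i k₁
    v₂ i = M₁ i k₁ + - 1# * M₁ i k₀
    v₃ i = M₂ i k₀ + 1# * M₂ i k₁
    M₁ = replaceColumn M k₀ v₁
    M₂ = replaceColumn M₁ k₁ v₂
    M₃ = replaceColumn M₂ k₀ v₃
    M₃≈ : ∀ i → M₃ i j ≈ M₃ i k₀
    M₃≈ i = begin
      M₃ i j                               ≈⟨ off M₂ k₀ v₃ i j≢k ⟩
      M₂ i j                               ≈⟨ off M₁ k₁ v₂ i j≢1+k ⟩
      M₁ i j                               ≈⟨ off M k₀ v₁ i j≢k ⟩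
      M i j                                ≈⟨ M≈ i ⟩
      x                                    ≈⟨ solve 2 (λ x y → x := (y :+ :1 :* x) :+ :1 :* (x :+ :- :1 :* (y :+ :1 :* x))) refl x y ⟩
      (y + 1# * x) + 1# * (x + - 1# * (y + 1# * x))
        ≈⟨ +-cong (at M k₀ v₁ i) (*-congˡ (+-cong (off M k₀ v₁ i 1+k≢k) (*-congˡ (at M k₀ v₁ i)))) ⟨
      M₁ i k₀ + 1# * (M₁ i k₁ + - 1# * M₁ i k₀)
        ≈⟨ +-cong (off M₁ k₁ v₂ i (1+k≢k ∘ ≡.sym)) (*-congˡ (at M₁ k₁ v₂ i)) ⟨
      M₂ i k₀ + 1# * M₂ i k₁               ≈⟨ at M₂ k₀ v₃ i ⟨
      M₃ i k₀                              ∎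
      where
      x = M i k₁
      y = M i k₀

  -- Induction on the right-hand column: it starts next to `j`, where the adjacent case applies, and
  -- `alternating-step` moves it one place at a time.
  alternating-< : (k : Fin n) {j : Fin n} → j Fin.< k → Alternating j k
  alternating-< {suc n} = <-weakInduction (λ k → ∀ {j} → j Fin.< k → Alternating j k) (λ ()) step
    where
    step : (k : Fin n) → (∀ {j} → j Fin.< inject₁ k → Alternating j (inject₁ k)) →
           ∀ {j} → j Fin.< suc k → Alternating j (suc k)
    step k ih {j} j<1+k with j Fin.≟ inject₁ k
    ... | yes ≡.refl = alternating-adjacent k
    ... | no j≢k     = alternating-step k j≢k (Fin.<⇒≢ j<1+k) (ih (Fin.≤∧≢⇒< j≤k j≢k))
      where
      j≤k : toℕ j ℕ.≤ toℕ (inject₁ k)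
      j≤k = ≡.subst (toℕ j ℕ.≤_) (≡.sym (Fin.toℕ-inject₁ k)) (ℕ.s≤s⁻¹ j<1+k)

  alternating : {j k : Fin n} → j ≢ k → Alternating j k
  alternating {j = j} {k} j≢k with ℕ.<-cmp (toℕ j) (toℕ k)
  ... | tri< j<k _ _ = alternating-< k j<k
  ... | tri≈ _ j≡k _ = contradiction (Fin.toℕ-injective j≡k) j≢k
  ... | tri> _ _ k<j = alternating-sym (alternating-< j k<j)

  -- Column operations and constant row sums.

  det-scale : (a : Carrier) (M : Matrix n) → det (λ i j → a * M i j) ≈ a ^ n * det M
  det-scale {zero}  a M = sym (*-identityˡ _)
  det-scale {suc n} a M = begin
    sum (λ j → (- 1#) ^ toℕ j * (a * M zero j * det (λ i k → a * minor M j i k)))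
      ≈⟨ sum-cong-≋ (λ j → trans (*-congˡ {x = (- 1#) ^ toℕ j} (*-congˡ {x = a * M zero j} (det-scale a (minor M j))))
           (solve 5 (λ s a x p d → s :* (a :* x :* (p :* d)) := a :* p :* (s :* (x :* d))) refl
             ((- 1#) ^ toℕ j) a (M zero j) (a ^ n) (det (minor M j)))) ⟩
    sum (λ j → a ^ suc n * term j)
      ≈⟨ *-distribˡ-sum (a ^ suc n) term ⟨
    a ^ suc n * sum term ∎
    where
    term : Fin (suc n) → Carrier
    term j = (- 1#) ^ toℕ j * (M zero j * det (minor M j))

  det-replaceColumn-linear : (M : Matrix n) (k : Fin n) (a b : Carrier) (v w : Fin n → Carrier) →
    det (replaceColumn M k (λ i → a * v i + b * w i)) ≈
    a * det (replaceColumn M k v) + b * det (replaceColumn M k w)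
  det-replaceColumn-linear M k a b v w = det-linear k a b
    (λ i j≢k → reflexive (≡.trans (replaceColumn-off M k _ i j≢k) (≡.sym (replaceColumn-off M k v i j≢k))))
    (λ i j≢k → reflexive (≡.trans (replaceColumn-off M k _ i j≢k) (≡.sym (replaceColumn-off M k w i j≢k))))
    (λ i → trans (reflexive (replaceColumn-at M k _ i))
      (sym (+-cong (*-congˡ (reflexive (replaceColumn-at M k v i))) (*-congˡ (reflexive (replaceColumn-at M k w i))))))

  replaceColumn-cong : {M N : Matrix n} (k : Fin n) {v w : Fin n → Carrier} →
    (∀ i {j} → j ≢ k → M i j ≈ N i j) → (∀ i → v i ≈ w i) →
    ∀ i j → replaceColumn M k v i j ≈ replaceColumn N k w i j
  replaceColumn-cong {M = M} {N} k {v} {w} M≈N v≈w i j with j Fin.≟ k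
  ... | yes ≡.refl = trans (reflexive (replaceColumn-at M k v i)) (trans (v≈w i) (reflexive (≡.sym (replaceColumn-at N k w i))))
  ... | no j≢k = trans (reflexive (replaceColumn-off M k v i j≢k)) (trans (M≈N i j≢k) (reflexive (≡.sym (replaceColumn-off N k w i j≢k))))

  det-replaceColumn-sum : ∀ {m} (M : Matrix n) (k : Fin n) (v : Fin m → Fin n → Carrier) →
    det (replaceColumn M k (λ i → sum (λ l → v l i))) ≈ sum (λ l → det (replaceColumn M k (v l)))
  det-replaceColumn-sum {m = zero} M k v = begin
    det (replaceColumn M k (λ _ → 0#))
      -- Written as a combination with both coefficients `0#`, the zero column makes the determinant
      -- vanish by linearity.
      ≈⟨ det-cong (replaceColumn-cong {M = M} k (λ _ _ → refl) (λ _ → solve 0 (:0 := :0 :* :0 :+ :0 :* :0) refl)) ⟩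
    det (replaceColumn M k (λ _ → 0# * 0# + 0# * 0#))
      ≈⟨ det-replaceColumn-linear M k 0# 0# _ _ ⟩
    0# * det (replaceColumn M k (λ _ → 0#)) + 0# * det (replaceColumn M k (λ _ → 0#))
      ≈⟨ solve 1 (λ d → :0 :* d :+ :0 :* d := :0) refl _ ⟩
    0# ∎
  det-replaceColumn-sum {m = suc m} M k v = begin
    det (replaceColumn M k (λ i → v zero i + rest i))
      ≈⟨ det-cong (replaceColumn-cong {M = M} k (λ _ _ → refl) (λ _ → sym (+-cong (*-identityˡ _) (*-identityˡ _)))) ⟩
    det (replaceColumn M k (λ i → 1# * v zero i + 1# * rest i))
      ≈⟨ det-replaceColumn-linear M k 1# 1# _ _ ⟩
    1# * det (replaceColumn M k (v zero)) + 1# * det (replaceColumn M k rest)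
      ≈⟨ +-cong (*-identityˡ _) (trans (*-identityˡ _) (det-replaceColumn-sum M k (v ∘ suc))) ⟩
    sum (λ l → det (replaceColumn M k (v l))) ∎
    where
    rest : Fin _ → Carrier
    rest i = sum (λ l → v (suc l) i)

  -- Adding all the other columns to the first one makes it constant.
  det-rowSums : (M : Matrix (suc n)) (ρ : Carrier) → (∀ i → sum (M i) ≈ ρ) →
                det M ≈ ρ * det (replaceColumn M zero (λ _ → 1#))
  det-rowSums {n} M ρ Mρ = sym $ begin
    ρ * det (replaceColumn M zero (λ _ → 1#))
      ≈⟨ solve 2 (λ ρ d → ρ :* d := ρ :* d :+ :0 :* d) refl ρ _ ⟩
    ρ * det (replaceColumn M zero (λ _ → 1#)) + 0# * det (replaceColumn M zero (λ _ → 1#))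
      ≈⟨ det-replaceColumn-linear M zero ρ 0# _ _ ⟨
    det (replaceColumn M zero (λ _ → ρ * 1# + 0# * 1#))
      ≈⟨ det-cong (replaceColumn-cong {M = M} zero (λ _ _ → refl)
           (λ i → trans (solve 1 (λ ρ → ρ :* :1 :+ :0 :* :1 := ρ) refl ρ) (sym (Mρ i)))) ⟩
    det (replaceColumn M zero (λ i → sum (λ j → M i j)))
      ≈⟨ det-replaceColumn-sum M zero (λ j i → M i j) ⟩
    det (replaceColumn M zero (λ i → M i zero)) + sum (λ j → det (replaceColumn M zero (λ i → M i (suc j))))
      ≈⟨ +-cong (det-cong {M = replaceColumn M zero (λ i → M i zero)} {M} λ { i zero → reflexive (replaceColumn-at M zero _ i) ; i (suc j) → reflexive (replaceColumn-off M zero _ i λ ()) })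
                (sum-zero λ j → alternating {j = zero} {suc j} (λ ()) (replaceColumn M zero (λ i → M i (suc j)))
                  (λ i → reflexive (≡.trans (replaceColumn-at M zero _ i) (≡.sym (replaceColumn-off M zero _ i λ ()))))) ⟩
    det M + 0#
      ≈⟨ +-identityʳ _ ⟩
    det M ∎

  -- Induction on `b`, a bound on the indices of the columns still to be cleared. That `a k` is zero
  -- keeps column `k` fixed throughout, so every round adds a multiple of the same column.
  det-addMultiples′ : (k : Fin n) (b : ℕ) (a : Fin n → Carrier) {M P : Matrix n} →
    a k ≈ 0# → (∀ {j} → b ℕ.≤ toℕ j → a j ≈ 0#) →
    (∀ i j → P i j ≈ M i j + a j * M i k) → det P ≈ det M
  det-addMultiples′ k zero a {M} ak≈0 a≈0 P≈ = det-cong λ i j →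
    trans (P≈ i j) (trans (+-congˡ (trans (*-congʳ (a≈0 ℕ.z≤n)) (zeroˡ _))) (+-identityʳ _))
  det-addMultiples′ {n} k (suc b) a {M} {P} ak≈0 a≈0 P≈ with b ℕ.<? n
  ... | no b≮n = det-addMultiples′ k b a ak≈0 (λ {j} b≤j → contradiction (ℕ.≤-<-trans b≤j (Fin.toℕ<n j)) b≮n) P≈
  ... | yes b<n with k Fin.≟ fromℕ< b<n
  -- The column whose turn it is is `k` itself, and its coefficient is already zero.
  ... | yes k≡l = det-addMultiples′ k b a ak≈0 vanish P≈
    where
    vanish : ∀ {j} → b ℕ.≤ toℕ j → a j ≈ 0#
    vanish {j} b≤j with b ℕ.≟ toℕ j
    ... | no b≢j  = a≈0 (ℕ.≤∧≢⇒< b≤j b≢j)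
    ... | yes b≡j = ≡.subst (λ j → a j ≈ 0#) (≡.trans k≡l (Fin.toℕ-injective (≡.trans (Fin.toℕ-fromℕ< b<n) b≡j))) ak≈0
  ... | no k≢l = begin
    det P    ≈⟨ det-addColumn k≢l (alternating k≢l) (a l) P≈P′ P-at-l ⟩
    det P′   ≈⟨ det-addMultiples′ k b a′ a′k≈0 vanish (λ _ _ → refl) ⟩
    det M    ∎
    where
    l : Fin n
    l = fromℕ< b<n
    a′ : Fin n → Carrier
    a′ = updateAt a l (const 0#)
    a′-off : ∀ {j} → j ≢ l → a′ j ≈ a j
    a′-off {j} j≢l = reflexive (Vector.updateAt-minimal j l a j≢l)
    a′-at : a′ l ≈ 0#
    a′-at = reflexive (Vector.updateAt-updates l a)
    a′k≈0 : a′ k ≈ 0#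
    a′k≈0 = trans (a′-off k≢l) ak≈0
    vanish : ∀ {j} → b ℕ.≤ toℕ j → a′ j ≈ 0#
    vanish {j} b≤j with j Fin.≟ l
    ... | yes ≡.refl = a′-at
    ... | no j≢l     = trans (a′-off j≢l) (a≈0 (ℕ.≤∧≢⇒< b≤j λ b≡j →
      j≢l (Fin.toℕ-injective (≡.trans (≡.sym b≡j) (≡.sym (Fin.toℕ-fromℕ< b<n))))))
    P′ : Matrix n
    P′ i j = M i j + a′ j * M i k
    P≈P′ : ∀ i {j} → j ≢ l → P i j ≈ P′ i j
    P≈P′ i j≢l = trans (P≈ i _) (+-congˡ (*-congʳ (sym (a′-off j≢l))))
    unchanged : ∀ i {j} → a′ j ≈ 0# → P′ i j ≈ M i j
    unchanged i a′j≈0 = trans (+-congˡ (trans (*-congʳ a′j≈0) (zeroˡ _))) (+-identityʳ _)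
    P-at-l : ∀ i → P i l ≈ P′ i l + a l * P′ i k
    P-at-l i = trans (P≈ i l) (sym (+-cong (unchanged i a′-at) (*-congˡ (unchanged i a′k≈0))))

  det-addMultiples : (k : Fin n) (a : Fin n → Carrier) {M P : Matrix n} → a k ≈ 0# →
    (∀ i j → P i j ≈ M i j + a j * M i k) → det P ≈ det M
  det-addMultiples {n} k a ak≈0 =
    det-addMultiples′ k n a ak≈0 (λ {j} n≤j → contradiction (Fin.toℕ<n j) (ℕ.≤⇒≯ n≤j))

  -- After the first column has been replaced by ones in both matrices, each other column differs by
  -- exactly that column, so both have the same determinant `d`. By `det-rowSums` the original
  -- determinants are `ρ * d` and `(ρ - suc n ×ℕ 1#) * d`; cross-multiplying removes `d` without a
  -- division.
  det-subtractOnes : (M : Matrix (suc n)) (ρ : Carrier) → (∀ i → sum (M i) ≈ ρ) →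
    ρ * det (λ i j → M i j - 1#) ≈ (ρ - suc n ×ℕ 1#) * det M
  det-subtractOnes {n} M ρ Mρ = begin
    ρ * det M⁻
      ≈⟨ *-congˡ (det-rowSums M⁻ (ρ - suc n ×ℕ 1#) M⁻ρ) ⟩
    ρ * ((ρ - suc n ×ℕ 1#) * det (replaceColumn M⁻ zero (λ _ → 1#)))
      ≈⟨ *-congˡ (*-congˡ (det-addMultiples zero coefficient refl
           M⁻-columns)) ⟩
    ρ * ((ρ - suc n ×ℕ 1#) * d)
      ≈⟨ solve 3 (λ ρ k d → ρ :* (k :* d) := k :* (ρ :* d)) refl ρ (ρ - suc n ×ℕ 1#) d ⟩
    (ρ - suc n ×ℕ 1#) * (ρ * d)
      ≈⟨ *-congˡ (det-rowSums M ρ Mρ) ⟨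
    (ρ - suc n ×ℕ 1#) * det M ∎
    where
    d : Carrier
    d = det (replaceColumn M zero (λ _ → 1#))
    M⁻ : Matrix (suc n)
    M⁻ i j = M i j - 1#
    coefficient : Fin (suc n) → Carrier
    coefficient zero    = 0#
    coefficient (suc _) = - 1#
    M⁻-columns : ∀ i j → replaceColumn M⁻ zero (λ _ → 1#) i j ≈
      replaceColumn M zero (λ _ → 1#) i j + coefficient j * replaceColumn M zero (λ _ → 1#) i zero
    M⁻-columns i zero = begin
      replaceColumn M⁻ zero (λ _ → 1#) i zero   ≡⟨ replaceColumn-at M⁻ zero _ i ⟩
      1#                                        ≡⟨ replaceColumn-at M zero _ i ⟨
      N i zero                                  ≈⟨ solve 1 (λ x → x := x :+ :0 :* x) refl (N i zero) ⟩
      N i zero + 0# * N i zero                  ∎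
      where N = replaceColumn M zero (λ _ → 1#)
    M⁻-columns i (suc j) = begin
      replaceColumn M⁻ zero (λ _ → 1#) i (suc j)  ≡⟨ replaceColumn-off M⁻ zero _ i (λ ()) ⟩
      M i (suc j) - 1#                            ≈⟨ +-cong (reflexive (replaceColumn-off M zero _ i (λ ()))) (trans (*-congˡ (reflexive (replaceColumn-at M zero _ i))) (*-identityʳ _)) ⟨
      N i (suc j) + - 1# * N i zero               ∎
      where N = replaceColumn M zero (λ _ → 1#)
    M⁻ρ : ∀ i → sum (M⁻ i) ≈ ρ - suc n ×ℕ 1#
    M⁻ρ i = begin
      sum (λ j → M i j - 1#)                      ≈⟨ ∑-distrib-+ (M i) (λ _ → - 1#) ⟩
      sum (M i) + sum {suc n} (λ _ → - 1#)        ≈⟨ +-cong (Mρ i) (sum-ones (suc n)) ⟩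
      ρ - suc n ×ℕ 1#                             ∎
      where
      sum-ones : ∀ m → sum {m} (λ _ → - 1#) ≈ - (m ×ℕ 1#)
      sum-ones zero    = solve 0 (:0 := :- :0) refl
      sum-ones (suc m) = trans (+-congˡ (sum-ones m)) (solve 1 (λ x → :- :1 :+ :- x := :- (:1 :+ x)) refl (m ×ℕ 1#))

-- The characteristic polynomial of the complement of a regular digraph.

module RegularDigraphs {c ℓ : Level} (R : CommutativeRing c ℓ) where
  open CommutativeRing R hiding (zero)
  open RingSolver R
  open Determinants R using (det-cong; det-scale; det-subtractOnes; sum-zero)
  open Matrices rawRing
  open SemiringSum semiring using (sum; sum-cong-≋; ∑-distrib-+; *-distribˡ-sum; sum-remove)
  open SemiringMult semiring using () renaming (_×_ to _×ℕ_)
  private module ∏ = MonoidSum *-commutativeMonoid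
  open RawSemiringDefinitions (RawRing.rawSemiring rawRing) using (_^_; product)
  open SetoidReasoning setoid

  indicator : Bool → Carrier
  indicator b = if b then 1# else 0#

  sum-indicator : (b : Fin n → Bool) → sum (indicator ∘ b) ≈ ∣ tabulate b ∣ ×ℕ 1#
  sum-indicator {zero}  b = refl
  sum-indicator {suc n} b with b zero
  ... | true  = +-congˡ (sum-indicator (b ∘ suc))
  ... | false = trans (+-identityˡ _) (sum-indicator (b ∘ suc))

  δ# : ℕ → Carrier
  δ# k = ⟦ δ k ⟧ℤ

  -- The integer identity `complement-adjacency`, transported along the map from ℤ to the ring. This
  -- is why `δ#` is taken as the image of the integer `δ`.
  adjacency-complement : (D : Digraph n) → ∀ i j →
    adjacency (complement D) i j ≈ 1# - δ# (Digraph.σ D) * identity i j - adjacency D i j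
  adjacency-complement D i j = begin
    adjacency (complement D) i j
      ≈⟨ ⟦⟧-indicator (Digraph.arc (complement D) i j) ⟨
    ⟦ ℤM.adjacency (complement D) i j ⟧ℤ
      ≡⟨ ≡.cong ⟦_⟧ℤ (complement-adjacency D i j) ⟩
    ⟦ 1ℤ ℤ.- δ k ℤ.* ℤM.identity i j ℤ.- ℤM.adjacency D i j ⟧ℤ
      ≈⟨ ⟦⟧-- (1ℤ ℤ.- δ k ℤ.* ℤM.identity i j) (ℤM.adjacency D i j) ⟩
    ⟦ 1ℤ ℤ.- δ k ℤ.* ℤM.identity i j ⟧ℤ - ⟦ ℤM.adjacency D i j ⟧ℤ
      ≈⟨ +-cong (⟦⟧-- 1ℤ (δ k ℤ.* ℤM.identity i j)) (-‿cong (⟦⟧-indicator (Digraph.arc D i j))) ⟩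
    1# - ⟦ δ k ℤ.* ℤM.identity i j ⟧ℤ - adjacency D i j
      ≈⟨ +-congʳ (+-congˡ (-‿cong (trans (⟦⟧-* (δ k) (ℤM.identity i j)) (*-congˡ (⟦⟧-indicator (does (i Fin.≟ j))))))) ⟩
    1# - δ# k * identity i j - adjacency D i j ∎
    where
    module ℤM = Matrices ℤ-rawRing
    k = Digraph.σ D
    ⟦⟧-indicator : ∀ b → ⟦ if b then 1ℤ else 0ℤ ⟧ℤ ≈ indicator b
    ⟦⟧-indicator true  = refl
    ⟦⟧-indicator false = refl
    ⟦⟧-- : ∀ x y → ⟦ x ℤ.- y ⟧ℤ ≈ ⟦ x ⟧ℤ - ⟦ y ⟧ℤ
    ⟦⟧-- x y = trans (⟦⟧-+ x (ℤ.- y)) (+-congˡ (⟦⟧-neg y))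

  identity-diagonal : (i : Fin n) → identity i i ≈ 1#
  identity-diagonal i rewrite dec-true (i Fin.≟ i) ≡.refl = refl

  identity-offDiagonal : {i j : Fin n} → i ≢ j → identity i j ≈ 0#
  identity-offDiagonal {i = i} {j} i≢j rewrite dec-false (i Fin.≟ j) i≢j = refl

  sum-identity : (i : Fin n) → sum (identity i) ≈ 1#
  sum-identity {suc n} i = begin
    sum (identity i)                                  ≈⟨ sum-remove (identity i) ⟩
    identity i i + sum (removeAt (identity i) i)      ≈⟨ +-cong (identity-diagonal i) (sum-zero λ j → identity-offDiagonal (Fin.punchInᵢ≢i i j ∘ ≡.sym)) ⟩
    1# + 0#                                           ≈⟨ +-identityʳ 1# ⟩
    1#                                                ∎

  -- For B = (z + δ) I + A, with row sums z + δ + r, the matrix z I − A(D̄) is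
  -- B − J, and B itself is − (w I − A) for w = − (z + δ).
  complement-spectrum : ∀ {m r} (D : Digraph (suc m)) → Regular r D → (ev ev′ : Vector Carrier (suc m)) →
    (∀ z → det (λ i j → z * identity i j + - adjacency D i j) ≈ product (λ i → z + - ev i)) →
    (∀ z → det (λ i j → z * identity i j + - adjacency (complement D) i j) ≈ product (λ i → z + - ev′ i)) →
    let d = δ# (Digraph.σ D)
        ρ = r ×ℕ 1#
    in ∀ z → product (λ i → z - ((- (d + ρ)) ∷ ev′) i) ≈
             product (λ i → z - ((suc m ×ℕ 1# - (d + ρ)) ∷ (λ i → - (d + ev i))) i)
  complement-spectrum {m} {r} D regular ev ev′ spectrum spectrum′ z = begin
    (z - - (d + ρ)) * product (λ i → z - ev′ i)
      ≈⟨ *-cong (solve 3 (λ z d ρ → z :- :- (d :+ ρ) := z :+ d :+ ρ) refl z d ρ) (sym (spectrum′ z)) ⟩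
    (z + d + ρ) * det (λ i j → z * identity i j + - adjacency (complement D) i j)
      ≈⟨ *-congˡ (det-cong λ i j → trans (+-congˡ (-‿cong (adjacency-complement D i j)))
           (solve 4 (λ z d I a → z :* I :- (:1 :- d :* I :- a) := (z :+ d) :* I :+ a :- :1) refl z d (identity i j) (adjacency D i j))) ⟩
    (z + d + ρ) * det (λ i j → B i j - 1#)
      ≈⟨ det-subtractOnes B (z + d + ρ) rowSum ⟩
    (z + d + ρ - suc m ×ℕ 1#) * det B
      ≈⟨ *-cong (solve 4 (λ z d ρ k → z :+ d :+ ρ :- k := z :- (k :- (d :+ ρ))) refl z d ρ (suc m ×ℕ 1#)) det-B ⟩
    (z - (suc m ×ℕ 1# - (d + ρ))) * product (λ i → z - - (d + ev i)) ∎
    where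
    d = δ# (Digraph.σ D)
    ρ = r ×ℕ 1#
    w = - (z + d)
    B : Matrix (suc m)
    B i j = (z + d) * identity i j + adjacency D i j

    rowSum : ∀ i → sum (B i) ≈ z + d + ρ
    rowSum i = begin
      sum (B i)
        ≈⟨ ∑-distrib-+ (λ j → (z + d) * identity i j) (adjacency D i) ⟩
      sum (λ j → (z + d) * identity i j) + sum (adjacency D i)
        ≈⟨ +-cong (sym (*-distribˡ-sum (z + d) (identity i))) (sum-indicator (Digraph.arc D i)) ⟩
      (z + d) * sum (identity i) + Digraph.outDegree D i ×ℕ 1#
        ≈⟨ +-cong (trans (*-congˡ (sum-identity i)) (*-identityʳ _)) (reflexive (≡.cong (_×ℕ 1#) (proj₁ (regular i)))) ⟩
      z + d + ρ ∎

    det-B : det B ≈ product (λ i → z - - (d + ev i))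
    det-B = begin
      det B
        ≈⟨ det-cong (λ i j → solve 4 (λ z d I a → (z :+ d) :* I :+ a := :- :1 :* (:- (z :+ d) :* I :- a)) refl z d (identity i j) (adjacency D i j)) ⟩
      det (λ i j → - 1# * (w * identity i j - adjacency D i j))
        ≈⟨ det-scale (- 1#) (λ i j → w * identity i j - adjacency D i j) ⟩
      (- 1#) ^ suc m * det (λ i j → w * identity i j - adjacency D i j)
        ≈⟨ *-cong (sym (∏.sum-replicate (suc m))) (spectrum w) ⟩
      product {suc m} (λ _ → - 1#) * product (λ i → w - ev i)
        ≈⟨ ∏.∑-distrib-+ (λ _ → - 1#) (λ i → w - ev i) ⟨
      product (λ i → - 1# * (w - ev i))
        ≈⟨ ∏.sum-cong-≋ (λ i → solve 3 (λ z d e → :- :1 :* (:- (z :+ d) :- e) := z :- :- (d :+ e)) refl z d (ev i)) ⟩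
      product (λ i → z - - (d + ev i)) ∎

-- Roots of products of linear factors over a domain of characteristic zero.

module Roots {c ℓ : Level} (R : CommutativeRing c ℓ)
  (zero-product : ∀ {x y} → CommutativeRing._≈_ R (CommutativeRing._*_ R x y) (CommutativeRing.0# R) →
    CommutativeRing._≈_ R x (CommutativeRing.0# R) ⊎ CommutativeRing._≈_ R y (CommutativeRing.0# R))
  (char-zero : ∀ k → ¬ CommutativeRing._≈_ R
    (SemiringMult._×_ (CommutativeRing.semiring R) (suc k) (CommutativeRing.1# R)) (CommutativeRing.0# R))
  where
  open CommutativeRing R hiding (zero)
  open RingSolver R
  open SemiringMult semiring using (×-homo-+) renaming (_×_ to _×ℕ_)
  open RawSemiringDefinitions (RawRing.rawSemiring rawRing) using (product)
  private module ∏ = MonoidSum *-commutativeMonoid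
  open SetoidReasoning setoid

  -- Polynomial functions without coefficients: the factor theorem serves as the definition. At
  -- every `a`, subtracting the value `f a` leaves a multiple of `x - a`, with a quotient whose
  -- degree bound is one lower.
  DegreeBelow : ℕ → (Carrier → Carrier) → Set (c ⊔ ℓ)
  DegreeBelow zero    f = ∀ x → f x ≈ 0#
  DegreeBelow (suc n) f = ∀ a → ∃[ q ] (DegreeBelow n q × (∀ x → f x ≈ f a + (x - a) * q x))

  degreeBelow-suc : ∀ n {f} → DegreeBelow n f → DegreeBelow (suc n) f
  degreeBelow-suc zero {f} f≈0 a = (λ _ → 0#) , (λ _ → refl) , λ x → begin
    f x                     ≈⟨ f≈0 x ⟩
    0#                      ≈⟨ f≈0 a ⟨
    f a                     ≈⟨ solve 2 (λ y z → y := y :+ z :* :0) refl (f a) (x - a) ⟩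
    f a + (x - a) * 0#      ∎
  degreeBelow-suc (suc n) Df a =
    let q , Dq , f≈ = Df a in q , degreeBelow-suc n Dq , f≈

  degreeBelow-+* : ∀ n {f g} (b : Carrier) → DegreeBelow n f → DegreeBelow n g →
                   DegreeBelow n (λ x → f x + b * g x)
  degreeBelow-+* zero b f≈0 g≈0 x = trans (+-cong (f≈0 x) (*-congˡ (g≈0 x))) (solve 1 (λ b → :0 :+ b :* :0 := :0) refl b)
  degreeBelow-+* (suc n) {f} {g} b Df Dg a =
    let p , Dp , f≈ = Df a
        q , Dq , g≈ = Dg a
    in (λ x → p x + b * q x) , degreeBelow-+* n b Dp Dq , λ x →
       trans (+-cong (f≈ x) (*-congˡ (g≈ x)))
             (solve 6 (λ y z p q b w → y :+ w :* p :+ b :* (z :+ w :* q) := y :+ b :* z :+ w :* (p :+ b :* q)) refl (f a) (g a) (p x) (q x) b (x - a))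

  -- Split `x - b` into `(x - a) + (a - b)` and expand `f x` at `a` in the second summand only; the
  -- quotient is then `f x + (a - b) * q x`.
  degreeBelow-linearFactor : ∀ n {f} (b : Carrier) → DegreeBelow (suc n) f →
                             DegreeBelow (suc (suc n)) (λ x → (x - b) * f x)
  degreeBelow-linearFactor n {f} b Df a =
    let q , Dq , f≈ = Df a
    in (λ x → f x + (a - b) * q x) , degreeBelow-+* (suc n) (a - b) Df (degreeBelow-suc n Dq) , λ x → begin
       (x - b) * f x
         ≈⟨ solve 4 (λ x b a y → (x :- b) :* y := (x :- a) :* y :+ (a :- b) :* y) refl x b a (f x) ⟩
       (x - a) * f x + (a - b) * f x
         ≈⟨ +-congˡ (*-congˡ (f≈ x)) ⟩
       (x - a) * f x + (a - b) * (f a + (x - a) * q x)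
         ≈⟨ solve 6 (λ x b a y q z → (x :- a) :* y :+ (a :- b) :* (z :+ (x :- a) :* q)
              := (a :- b) :* z :+ (x :- a) :* (y :+ (a :- b) :* q)) refl x b a (f x) (q x) (f a) ⟩
       (a - b) * f a + (x - a) * (f x + (a - b) * q x) ∎

  degreeBelow-product : (a : Vector Carrier n) → DegreeBelow (suc n) (λ x → product (λ i → x - a i))
  degreeBelow-product {zero}  a b = (λ _ → 0#) , (λ _ → refl) , λ x → solve 1 (λ y → :1 := :1 :+ y :* :0) refl (x - b)
  degreeBelow-product {suc n} a   = degreeBelow-linearFactor n (a zero) (degreeBelow-product (tail a))

  -- Dividing out the root `p 0` leaves a quotient that vanishes at all later points, because the
  -- differences `p (suc k) - p 0` are nonzero. With an infinite sequence of points nothing has to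
  -- be counted: `p ∘ suc` serves for the quotient.
  manyZeros⇒zero : ∀ n {f} (p : ℕ → Carrier) → DegreeBelow n f →
    (∀ i j → ¬ p (i ℕ.+ suc j) - p i ≈ 0#) → (∀ k → f (p k) ≈ 0#) → ∀ x → f x ≈ 0#
  manyZeros⇒zero zero    p f≈0 distinct zeros = f≈0
  manyZeros⇒zero (suc n) {f} p Df distinct zeros x =
    let q , Dq , f≈ = Df (p 0)
        q-zeros k = [ (λ eq → contradiction eq (distinct 0 k)) , (λ eq → eq) ]′
          (zero-product (begin
            (p (suc k) - p 0) * q (p (suc k))             ≈⟨ +-identityˡ _ ⟨
            0# + (p (suc k) - p 0) * q (p (suc k))        ≈⟨ +-congʳ (zeros 0) ⟨
            f (p 0) + (p (suc k) - p 0) * q (p (suc k))   ≈⟨ f≈ (p (suc k)) ⟨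
            f (p (suc k))                                 ≈⟨ zeros (suc k) ⟩
            0#                                            ∎))
        q≈0 = manyZeros⇒zero n (p ∘ suc) Dq (λ i j → distinct (suc i) j) q-zeros
    in trans (f≈ x) (trans (+-cong (zeros 0) (*-congˡ (q≈0 x))) (solve 1 (λ y → :0 :+ y :* :0 := :0) refl (x - p 0)))

  -- The cofactors agree at a + 1, a + 2, …, hence also at a.
  cancel-linearFactor : (a : Carrier) (v w : Vector Carrier n) →
    (∀ x → (x - a) * product (λ i → x - v i) ≈ (x - a) * product (λ i → x - w i)) →
    ∀ x → product (λ i → x - v i) ≈ product (λ i → x - w i)
  cancel-linearFactor {n} a v w eq x = begin
    P x                           ≈⟨ solve 2 (λ p q → p := q :+ (p :+ :- :1 :* q)) refl (P x) (Q x) ⟩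
    Q x + (P x + - 1# * Q x)      ≈⟨ +-congˡ (manyZeros⇒zero (suc n) points (degreeBelow-+* (suc n) (- 1#) (degreeBelow-product v) (degreeBelow-product w)) distinct zeros x) ⟩
    Q x + 0#                      ≈⟨ +-identityʳ _ ⟩
    Q x                           ∎
    where
    P Q : Carrier → Carrier
    P x = product (λ i → x - v i)
    Q x = product (λ i → x - w i)
    points : ℕ → Carrier
    points k = a + suc k ×ℕ 1#
    distinct : ∀ i j → ¬ points (i ℕ.+ suc j) - points i ≈ 0#
    distinct i j eq = char-zero j (begin
      suc j ×ℕ 1#                                                 ≈⟨ solve 3 (λ a y z → z := a :+ (y :+ z) :- (a :+ y)) refl a (suc i ×ℕ 1#) (suc j ×ℕ 1#) ⟩
      a + (suc i ×ℕ 1# + suc j ×ℕ 1#) - points i                  ≈⟨ +-congʳ (+-congˡ (×-homo-+ 1# (suc i) (suc j))) ⟨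
      points (i ℕ.+ suc j) - points i                             ≈⟨ eq ⟩
      0#                                                          ∎)
    zeros : ∀ k → P (points k) + - 1# * Q (points k) ≈ 0#
    zeros k = [ (λ y≈0 → contradiction (trans (solve 2 (λ a y → y := a :+ y :- a) refl a (suc k ×ℕ 1#)) y≈0) (char-zero k)) , (λ eq → eq) ]′
      (zero-product (begin
        (y - a) * (P y + - 1# * Q y)              ≈⟨ solve 3 (λ z p q → z :* (p :+ :- :1 :* q) := z :* p :- z :* q) refl (y - a) (P y) (Q y) ⟩
        (y - a) * P y - (y - a) * Q y             ≈⟨ +-congʳ (eq y) ⟩
        (y - a) * Q y - (y - a) * Q y             ≈⟨ -‿inverseʳ _ ⟩
        0#                                        ∎))
      where y = points k

  product-zero : (v : Vector Carrier n) → product v ≈ 0# → ∃[ i ] v i ≈ 0#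
  product-zero {zero}  v eq = contradiction (trans (+-identityʳ 1#) eq) (char-zero 0)
  product-zero {suc n} v eq with zero-product eq
  ... | inj₁ v₀≈0 = zero , v₀≈0
  ... | inj₂ rest≈0 = let i , vᵢ≈0 = product-zero (tail v) rest≈0 in suc i , vᵢ≈0

  module _ {c′ ℓ′ : Level} (M : CommutativeMonoid c′ ℓ′) where
    private
      module M = CommutativeMonoid M
      module ∑ = MonoidSum M
    open ∑ using (sum)

    -- The head `a` of `v` is a zero of the left product, hence of the right one, so some `w i`
    -- equals it; both are removed and the factor `x - a` is cancelled. Comparing sums for an
    -- arbitrary `φ` stands in for equality of multisets and spares a permutation.
    sum-over-roots : (φ : Carrier → M.Carrier) → (∀ {x y} → x ≈ y → φ x M.≈ φ y) →
      (v w : Vector Carrier n) → (∀ x → product (λ i → x - v i) ≈ product (λ i → x - w i)) →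
      sum (φ ∘ v) M.≈ sum (φ ∘ w)
    sum-over-roots {zero}  φ φ-cong v w eq = M.refl
    sum-over-roots {suc n} φ φ-cong v w eq =
      let a = v zero
          i , a-wᵢ≈0 = product-zero (λ i → a - w i) (trans (sym (eq a)) (trans (*-congʳ (-‿inverseʳ a)) (zeroˡ _)))
          a≈wᵢ = trans (solve 2 (λ a b → a := b :+ (a :- b)) refl a (w i)) (trans (+-congˡ a-wᵢ≈0) (+-identityʳ _))
          eq′ x = begin
            (x - a) * product (λ j → x - tail v j)              ≈⟨ eq x ⟩
            product (λ j → x - w j)                             ≈⟨ ∏.sum-remove {i = i} (λ j → x - w j) ⟩
            (x - w i) * product (λ j → x - removeAt w i j)      ≈⟨ *-congʳ (+-congˡ (-‿cong (sym a≈wᵢ))) ⟩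
            (x - a) * product (λ j → x - removeAt w i j)        ∎
      in M.trans (M.∙-cong (φ-cong a≈wᵢ) (sum-over-roots φ φ-cong (tail v) (removeAt w i) (cancel-linearFactor a (tail v) (removeAt w i) eq′)))
                 (M.sym (∑.sum-remove {i = i} (φ ∘ w)))

-- Ordered fields: signs, absolute values and finite sums.

module OrderedField {c ℓ₁ ℓ₂ : Level} (ℝ : Reals c ℓ₁ ℓ₂) where
  open Reals ℝ hiding (zero)
  open IsDecTotalOrder isDecTotalOrder public using (total; antisym; ≤-respˡ-≈; ≤-respʳ-≈)
    renaming (refl to ≤-refl; trans to ≤-trans; reflexive to ≤-reflexive)
  open RingSolver commutativeRing
  open RingProperties ring public using (-0#≈0#; -‿involutive)
  open SetoidReasoning setoid

  -- The usual route to an inequality below: the ring solver turns the difference into an expression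
  -- already known to be nonnegative.
  0≤⇒≤ : ∀ {x y u} → y - x ≈ u → 0# ≤ u → x ≤ y
  0≤⇒≤ {x} {y} {u} eq 0≤u =
    ≤-respˡ-≈ (+-identityˡ x)
      (≤-respʳ-≈ (trans (+-congʳ (sym eq)) (solve 2 (λ x y → y :- x :+ x := y) refl x y)) (+-monoˡ-≤ x 0≤u))

  ≤⇒0≤ : ∀ {x y} → x ≤ y → 0# ≤ y - x
  ≤⇒0≤ {x} x≤y = ≤-respˡ-≈ (-‿inverseʳ x) (+-monoˡ-≤ (- x) x≤y)

  x≤s⇒x-s≤0 : ∀ {x s} → x ≤ s → x - s ≤ 0#
  x≤s⇒x-s≤0 {x} {s} x≤s = ≤-respʳ-≈ (-‿inverseʳ s) (+-monoˡ-≤ (- s) x≤s)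

  x≤-t⇒x+t≤0 : ∀ {x t} → x ≤ - t → x + t ≤ 0#
  x≤-t⇒x+t≤0 {x} {t} x≤-t = ≤-respʳ-≈ (-‿inverseˡ t) (+-monoˡ-≤ t x≤-t)

  x+t≤0⇒x≤-t : ∀ {x t} → x + t ≤ 0# → x ≤ - t
  x+t≤0⇒x≤-t {x} {t} x+t≤0 = 0≤⇒≤ (solve 2 (λ x t → :- t :- x := :0 :- (x :+ t)) refl x t) (≤⇒0≤ x+t≤0)

  0≤x+t⇒-t≤x : ∀ {x t} → 0# ≤ x + t → - t ≤ x
  0≤x+t⇒-t≤x {x} {t} = 0≤⇒≤ (solve 2 (λ x t → x :- :- t := x :+ t) refl x t)

  -t≤x⇒0≤x+t : ∀ {x t} → - t ≤ x → 0# ≤ x + t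
  -t≤x⇒0≤x+t {x} {t} -t≤x = ≤-respʳ-≈ (solve 2 (λ x t → x :- :- t := x :+ t) refl x t) (≤⇒0≤ -t≤x)

  ≰⇒> : ∀ {x y} → ¬ x ≤ y → y < x
  ≰⇒> x≰y = [ (λ x≤y → contradiction x≤y x≰y) , (λ y≤x → y≤x , λ y≈x → x≰y (≤-reflexive (sym y≈x))) ]′ (total _ _)

  0≤+ : ∀ {x y} → 0# ≤ x → 0# ≤ y → 0# ≤ x + y
  0≤+ {x} {y} 0≤x 0≤y = ≤-trans 0≤y (≤-respˡ-≈ (+-identityˡ y) (+-monoˡ-≤ y 0≤x))

  +-mono-≤ : ∀ {w x y z} → w ≤ x → y ≤ z → w + y ≤ x + z
  +-mono-≤ {w} {x} {y} {z} w≤x y≤z =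
    0≤⇒≤ (solve 4 (λ w x y z → (x :+ z) :- (w :+ y) := (x :- w) :+ (z :- y)) refl w x y z) (0≤+ (≤⇒0≤ w≤x) (≤⇒0≤ y≤z))

  neg-mono-≤ : ∀ {x y} → x ≤ y → - y ≤ - x
  neg-mono-≤ {x} {y} x≤y = 0≤⇒≤ (solve 2 (λ x y → :- x :- :- y := y :- x) refl x y) (≤⇒0≤ x≤y)

  *-monoˡ-≤ : ∀ z {x y} → 0# ≤ z → x ≤ y → x * z ≤ y * z
  *-monoˡ-≤ z {x} {y} 0≤z x≤y =
    0≤⇒≤ (solve 3 (λ x y z → y :* z :- x :* z := (y :- x) :* z) refl x y z) (*-nonNegative (≤⇒0≤ x≤y) 0≤z)

  0≤x² : ∀ x → 0# ≤ x * x
  0≤x² x with total 0# x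
  ... | inj₁ 0≤x = *-nonNegative 0≤x 0≤x
  ... | inj₂ x≤0 = ≤-respʳ-≈ (solve 1 (λ x → :- x :* :- x := x :* x) refl x) (*-nonNegative 0≤-x 0≤-x)
    where
    0≤-x : 0# ≤ - x
    0≤-x = ≤-respˡ-≈ -0#≈0# (neg-mono-≤ x≤0)

  0≤1 : 0# ≤ 1#
  0≤1 = ≤-respʳ-≈ (*-identityˡ 1#) (0≤x² 1#)

  1≰0 : ¬ 1# ≤ 0#
  1≰0 1≤0 = 0≉1 (antisym 0≤1 1≤0)

  0≤fromℕ : ∀ k → 0# ≤ fromℕ k
  0≤fromℕ zero    = ≤-refl
  0≤fromℕ (suc k) = 0≤+ 0≤1 (0≤fromℕ k)

  1≤fromℕ-suc : ∀ k → 1# ≤ fromℕ (suc k)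
  1≤fromℕ-suc k = 0≤⇒≤ (solve 1 (λ x → :1 :+ x :- :1 := x) refl (fromℕ k)) (0≤fromℕ k)

  fromℕ-suc≉0 : ∀ k → fromℕ (suc k) ≉ 0#
  fromℕ-suc≉0 k eq = 1≰0 (≤-respʳ-≈ eq (1≤fromℕ-suc k))

  zero-product : ∀ {x y} → x * y ≈ 0# → x ≈ 0# ⊎ y ≈ 0#
  zero-product {x} {y} xy≈0 with x ≟ 0#
  ... | yes x≈0 = inj₁ x≈0
  ... | no x≉0  = inj₂ (begin
    y                    ≈⟨ *-identityʳ y ⟨
    y * 1#               ≈⟨ *-congˡ (⁻¹-inverseʳ x≉0) ⟨
    y * (x * x ⁻¹)       ≈⟨ solve 3 (λ x y z → y :* (x :* z) := x :* y :* z) refl x y (x ⁻¹) ⟩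
    x * y * x ⁻¹         ≈⟨ *-congʳ xy≈0 ⟩
    0# * x ⁻¹            ≈⟨ zeroˡ _ ⟩
    0#                   ∎)

  sumOfSquares-zero : ∀ {x y} → x * x + y * y ≈ 0# → x ≈ 0# × y ≈ 0#
  sumOfSquares-zero {x} {y} eq = first eq , first (trans (+-comm _ _) eq)
    where
    first : ∀ {x y} → x * x + y * y ≈ 0# → x ≈ 0#
    first {x} {y} eq = [ (λ x≈0 → x≈0) , (λ x≈0 → x≈0) ]′ (zero-product (antisym
      (≤-respʳ-≈ eq (0≤⇒≤ (solve 2 (λ a b → a :+ b :- a := b) refl (x * x) (y * y)) (0≤x² y)))
      (0≤x² x)))

  -- The inverse is `x` times the square of the inverse.
  0≤⁻¹ : ∀ {x} → x ≉ 0# → 0# ≤ x → 0# ≤ x ⁻¹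
  0≤⁻¹ {x} x≉0 0≤x = ≤-respʳ-≈ (begin
    x * (x ⁻¹ * x ⁻¹)    ≈⟨ *-assoc _ _ _ ⟨
    x * x ⁻¹ * x ⁻¹      ≈⟨ *-congʳ (⁻¹-inverseʳ x≉0) ⟩
    1# * x ⁻¹            ≈⟨ *-identityˡ _ ⟩
    x ⁻¹                 ∎) (*-nonNegative 0≤x (0≤x² (x ⁻¹)))

  /-cancelʳ : ∀ x {y} → y ≉ 0# → x * y / y ≈ x
  /-cancelʳ x {y} y≉0 = trans (*-assoc x y (y ⁻¹)) (trans (*-congˡ (⁻¹-inverseʳ y≉0)) (*-identityʳ x))

  abs-nonNegative : ∀ {x} → 0# ≤ x → abs x ≈ x
  abs-nonNegative {x} 0≤x rewrite dec-true (0# ≤? x) 0≤x = refl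

  abs-nonPositive : ∀ {x} → x ≤ 0# → abs x ≈ - x
  abs-nonPositive {x} x≤0 with 0# ≤? x
  ... | no _    = refl
  -- `abs` sends zero to its nonnegative branch, so here `x` is zero and equals its own negative.
  ... | yes 0≤x = trans x≈0 (sym (trans (-‿cong x≈0) -0#≈0#))
    where
    x≈0 : x ≈ 0#
    x≈0 = antisym x≤0 0≤x

  abs-cong : ∀ {x y} → x ≈ y → abs x ≈ abs y
  abs-cong {x} {y} x≈y with total 0# x
  ... | inj₁ 0≤x = trans (abs-nonNegative 0≤x) (trans x≈y (sym (abs-nonNegative (≤-respʳ-≈ x≈y 0≤x))))
  ... | inj₂ x≤0 = trans (abs-nonPositive x≤0) (trans (-‿cong x≈y) (sym (abs-nonPositive (≤-respˡ-≈ x≈y x≤0))))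

  abs-neg : ∀ x → abs (- x) ≈ abs x
  abs-neg x with total 0# x
  ... | inj₁ 0≤x = trans (abs-nonPositive (≤-respʳ-≈ -0#≈0# (neg-mono-≤ 0≤x))) (trans (-‿involutive x) (sym (abs-nonNegative 0≤x)))
  ... | inj₂ x≤0 = trans (abs-nonNegative (≤-respˡ-≈ -0#≈0# (neg-mono-≤ x≤0))) (sym (abs-nonPositive x≤0))

  0≤sum : {f : Vector Carrier n} → (∀ i → 0# ≤ f i) → 0# ≤ sum f
  0≤sum {zero}  0≤f = ≤-refl
  0≤sum {suc n} 0≤f = 0≤+ (0≤f zero) (0≤sum (0≤f ∘ suc))

  term≤sum : {f : Vector Carrier n} → (∀ i → 0# ≤ f i) → ∀ i → f i ≤ sum f
  term≤sum {f = f} 0≤f zero = 0≤⇒≤ (solve 2 (λ a b → a :+ b :- a := b) refl (f zero) (sum (tail f))) (0≤sum (0≤f ∘ suc))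
  term≤sum {f = f} 0≤f (suc i) = ≤-respˡ-≈ (+-identityˡ _) (+-mono-≤ (0≤f zero) (term≤sum (0≤f ∘ suc) i))

  sum-mono-≤ : {f g : Vector Carrier n} → (∀ i → f i ≤ g i) → sum f ≤ sum g
  sum-mono-≤ {zero}  f≤g = ≤-refl
  sum-mono-≤ {suc n} f≤g = +-mono-≤ (f≤g zero) (sum-mono-≤ (f≤g ∘ suc))

  sum-const : ∀ n x → sum {n} (λ _ → x) ≈ x * fromℕ n
  sum-const zero    x = sym (zeroʳ x)
  sum-const (suc n) x = trans (+-congˡ (sum-const n x)) (solve 2 (λ x k → x :+ x :* k := x :* (:1 :+ k)) refl x (fromℕ n))

-- The complex numbers as a domain, and the spectrum of the complement through real parts.

module ComplexField {c ℓ₁ ℓ₂ : Level} (ℝ : Reals c ℓ₁ ℓ₂) where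
  open Spectral ℝ hiding (zero)
  open OrderedField ℝ using (zero-product; sumOfSquares-zero; fromℕ-suc≉0)
  open RingSolver commutativeRing
  open RawSemiringDefinitions (RawRing.rawSemiring ℂ-rawRing) using () renaming (_×_ to _×ℂ_)
  private module C = RawRing ℂ-rawRing

  ℂ-commutativeRing : CommutativeRing c ℓ₁
  ℂ-commutativeRing = record
    { _≈_ = C._≈_ ; _+_ = C._+_ ; _*_ = C._*_ ; -_ = C.-_ ; 0# = C.0# ; 1# = C.1#
    ; isCommutativeRing = record
      { isRing = record
        { +-isAbelianGroup = record
          { isGroup = record
            { isMonoid = record
              { isSemigroup = record
                { isMagma = record
                  { isEquivalence = record
                    { refl  = refl , refl
                    ; sym   = λ (p , q) → sym p , sym q
                    ; trans = λ (p , q) (p′ , q′) → trans p p′ , trans q q′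
                    }
                  ; ∙-cong = λ (p , q) (p′ , q′) → +-cong p p′ , +-cong q q′
                  }
                ; assoc = λ _ _ _ → +-assoc _ _ _ , +-assoc _ _ _
                }
              ; identity = (λ _ → +-identityˡ _ , +-identityˡ _) , (λ _ → +-identityʳ _ , +-identityʳ _)
              }
            ; inverse = (λ _ → -‿inverseˡ _ , -‿inverseˡ _) , (λ _ → -‿inverseʳ _ , -‿inverseʳ _)
            ; ⁻¹-cong = λ (p , q) → -‿cong p , -‿cong q
            }
          ; comm = λ _ _ → +-comm _ _ , +-comm _ _
          }
        ; *-cong = λ (p , q) (p′ , q′) →
            +-cong (*-cong p p′) (-‿cong (*-cong q q′)) , +-cong (*-cong p q′) (*-cong q p′)
        ; *-assoc = λ (a +i b) (c +i d) (e +i f) →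
            solve 6 (λ a b c d e f → (a :* c :- b :* d) :* e :- (a :* d :+ b :* c) :* f
                                  := a :* (c :* e :- d :* f) :- b :* (c :* f :+ d :* e)) refl a b c d e f ,
            solve 6 (λ a b c d e f → (a :* c :- b :* d) :* f :+ (a :* d :+ b :* c) :* e
                                  := a :* (c :* f :+ d :* e) :+ b :* (c :* e :- d :* f)) refl a b c d e f
        ; *-identity =
            (λ (a +i b) → solve 2 (λ a b → :1 :* a :- :0 :* b := a) refl a b ,
                          solve 2 (λ a b → :1 :* b :+ :0 :* a := b) refl a b) ,
            (λ (a +i b) → solve 2 (λ a b → a :* :1 :- b :* :0 := a) refl a b ,
                          solve 2 (λ a b → a :* :0 :+ b :* :1 := b) refl a b)
        ; distrib =
            (λ (a +i b) (c +i d) (e +i f) →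
              solve 6 (λ a b c d e f → a :* (c :+ e) :- b :* (d :+ f)
                                    := (a :* c :- b :* d) :+ (a :* e :- b :* f)) refl a b c d e f ,
              solve 6 (λ a b c d e f → a :* (d :+ f) :+ b :* (c :+ e)
                                    := (a :* d :+ b :* c) :+ (a :* f :+ b :* e)) refl a b c d e f) ,
            (λ (a +i b) (c +i d) (e +i f) →
              solve 6 (λ a b c d e f → (c :+ e) :* a :- (d :+ f) :* b
                                    := (c :* a :- d :* b) :+ (e :* a :- f :* b)) refl a b c d e f ,
              solve 6 (λ a b c d e f → (c :+ e) :* b :+ (d :+ f) :* a
                                    := (c :* b :+ d :* a) :+ (e :* b :+ f :* a)) refl a b c d e f)
        }
      ; *-comm = λ (a +i b) (c +i d) →
          solve 4 (λ a b c d → a :* c :- b :* d := c :* a :- d :* b) refl a b c d ,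
          solve 4 (λ a b c d → a :* d :+ b :* c := c :* b :+ d :* a) refl a b c d
      }
    }

  -- ∣z∣² ∣w∣² = ∣z w∣²
  ℂ-zero-product : ∀ {z w} → z C.* w ≈ℂ C.0# → z ≈ℂ C.0# ⊎ w ≈ℂ C.0#
  ℂ-zero-product {a +i b} {c +i d} (re≈0 , im≈0) with zero-product norms≈0
    where
    norms≈0 : (a * a + b * b) * (c * c + d * d) ≈ 0#
    norms≈0 = trans
      (solve 4 (λ a b c d → (a :* a :+ b :* b) :* (c :* c :+ d :* d) :=
        (a :* c :- b :* d) :* (a :* c :- b :* d) :+ (a :* d :+ b :* c) :* (a :* d :+ b :* c)) refl a b c d)
      (trans (+-cong (*-cong re≈0 re≈0) (*-cong im≈0 im≈0)) (solve 0 (:0 :* :0 :+ :0 :* :0 := :0) refl))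
  ... | inj₁ eq = inj₁ (sumOfSquares-zero eq)
  ... | inj₂ eq = inj₂ (sumOfSquares-zero eq)

  re-×ℂ : ∀ k → re (k ×ℂ C.1#) ≈ fromℕ k
  re-×ℂ zero    = refl
  re-×ℂ (suc k) = +-congˡ (re-×ℂ k)

  ℂ-char-zero : ∀ k → ¬ suc k ×ℂ C.1# ≈ℂ C.0#
  ℂ-char-zero k (re≈0 , _) = fromℕ-suc≉0 k (trans (sym (re-×ℂ (suc k))) re≈0)

  module ℂ-digraphs = RegularDigraphs ℂ-commutativeRing
  module ℝ-digraphs = RegularDigraphs commutativeRing

  re-δ# : ∀ k → re (ℂ-digraphs.δ# k) ≈ ℝ-digraphs.δ# k
  re-δ# zero    = refl
  re-δ# (suc _) = refl

  -- The equality of root multisets from `complement-spectrum`, tested against `φ` of the real part.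
  -- The constants there are formed in ℂ; `re-δ#` and `re-×ℂ` bring them down to the reals.
  spectrum-sum : ∀ {m r} (D : Digraph (suc m)) → Regular r D →
    (ev ev′ : Vector ℂ (suc m)) → IsDigraphSpectrum D ev → IsDigraphSpectrum (complement D) ev′ →
    (φ : Carrier → Carrier) → (∀ {x y} → x ≈ y → φ x ≈ φ y) →
    let d = ℝ-digraphs.δ# (Digraph.σ D) in
    φ (- (d + fromℕ r)) + sum (λ i → φ (re (ev′ i))) ≈
    φ (fromℕ (suc m) - (d + fromℕ r)) + sum (λ i → φ (- (d + re (ev i))))
  spectrum-sum {m} {r} D regular ev ev′ spectrum spectrum′ φ φ-cong = begin
    φ (- (d + fromℕ r)) + sum (λ i → φ (re (ev′ i)))
      ≈⟨ +-congʳ (φ-cong (-‿cong (+-cong (re-δ# (Digraph.σ D)) (re-×ℂ r)))) ⟨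
    φ (- (re dℂ + re (r ×ℂ C.1#))) + sum (λ i → φ (re (ev′ i)))
      ≈⟨ sum-over-roots +-commutativeMonoid (φ ∘ re) (φ-cong ∘ proj₁) v w
           (ℂ-digraphs.complement-spectrum D regular ev ev′ spectrum spectrum′) ⟩
    φ (re (suc m ×ℂ C.1#) - (re dℂ + re (r ×ℂ C.1#))) + sum (λ i → φ (- (re dℂ + re (ev i))))
      ≈⟨ +-cong (φ-cong (+-cong (re-×ℂ (suc m)) (-‿cong (+-cong (re-δ# (Digraph.σ D)) (re-×ℂ r)))))
                (sum-cong-≋ {n = suc m} (λ i → φ-cong (-‿cong (+-congʳ {x = re (ev i)} (re-δ# (Digraph.σ D)))))) ⟩
    φ (fromℕ (suc m) - (d + fromℕ r)) + sum (λ i → φ (- (d + re (ev i)))) ∎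
    where
    open SetoidReasoning setoid
    open SemiringSum semiring using (sum-cong-≋)
    open Roots ℂ-commutativeRing ℂ-zero-product ℂ-char-zero using (sum-over-roots)
    d : Carrier
    d = ℝ-digraphs.δ# (Digraph.σ D)
    dℂ : ℂ
    dℂ = ℂ-digraphs.δ# (Digraph.σ D)
    v w : Vector ℂ (suc (suc m))
    v = (C.- (dℂ C.+ r ×ℂ C.1#)) ∷ ev′
    w = (suc m ×ℂ C.1# C.+ C.- (dℂ C.+ r ×ℂ C.1#)) ∷ (λ i → C.- (dℂ C.+ ev i))

-- The two energies as one sum over the spectrum of the digraph.

module EnergySum {c ℓ₁ ℓ₂ : Level} (ℝ : Reals c ℓ₁ ℓ₂) where
  open Spectral ℝ hiding (zero)
  open OrderedField ℝ
  open ComplexField ℝ using (spectrum-sum)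
  open RegularDigraphs commutativeRing
  open Matrices rawRing using (adjacency)
  open RingSolver commutativeRing
  open SemiringSum semiring using (sum-cong-≋; ∑-distrib-+; *-distribˡ-sum)
  open SetoidReasoning setoid

  0≤indicator : ∀ b → 0# ≤ indicator b
  0≤indicator true  = 0≤1
  0≤indicator false = ≤-refl

  -- A diagonal entry is one of the nonnegative entries of its row, so it is at most the row sum.
  sum-diagonal-≤ : (b : Fin n → Fin n → Bool) (ρ : Carrier) → (∀ v → sum (indicator ∘ b v) ≈ ρ) →
                   sum (λ v → indicator (b v v)) ≤ ρ * fromℕ n
  sum-diagonal-≤ {n} b ρ rows = ≤-respʳ-≈ (sum-const n ρ)
    (sum-mono-≤ (λ v → ≤-respʳ-≈ (rows v) (term≤sum {f = indicator ∘ b v} (0≤indicator ∘ b v) v)))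

  sum-indicator-not : (b : Fin n → Bool) → sum (indicator ∘ not ∘ b) ≈ fromℕ n - fromℕ ∣ tabulate b ∣
  sum-indicator-not {n} b = begin
    sum (indicator ∘ not ∘ b)
      ≈⟨ sum-cong-≋ (λ i → indicator-not (b i)) ⟩
    sum (λ i → 1# + - 1# * indicator (b i))
      ≈⟨ ∑-distrib-+ (λ _ → 1#) (λ i → - 1# * indicator (b i)) ⟩
    sum {n} (λ _ → 1#) + sum (λ i → - 1# * indicator (b i))
      ≈⟨ +-cong (sum-const n 1#) (sym (*-distribˡ-sum (- 1#) (indicator ∘ b))) ⟩
    1# * fromℕ n + - 1# * sum (indicator ∘ b)
      ≈⟨ +-cong (*-identityˡ _) (*-congˡ (sum-indicator b)) ⟩
    fromℕ n + - 1# * fromℕ ∣ tabulate b ∣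
      ≈⟨ solve 2 (λ x y → x :+ :- :1 :* y := x :- y) refl _ _ ⟩
    fromℕ n - fromℕ ∣ tabulate b ∣ ∎
    where
    indicator-not : ∀ b → indicator (not b) ≈ 1# + - 1# * indicator b
    indicator-not true  = solve 0 (:0 := :1 :+ :- :1 :* :1) refl
    indicator-not false = solve 0 (:1 := :1 :+ :- :1 :* :0) refl

  module _ {m r : ℕ} (D : Digraph (suc m)) (regular : Regular r D) where
    private
      n# σ# ρ s t d : Carrier
      n# = fromℕ (suc m)
      σ# = fromℕ (Digraph.σ D)
      ρ = fromℕ r
      s = σ/n D
      t = (n# - σ#) / n#
      d = δ# (Digraph.σ D)

      n≉0 : n# ≉ 0#
      n≉0 = fromℕ-suc≉0 m

    0≤n⁻¹ : 0# ≤ n# ⁻¹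
    0≤n⁻¹ = 0≤⁻¹ n≉0 (0≤fromℕ (suc m))

    s+t≈1 : s + t ≈ 1#
    s+t≈1 = trans (solve 3 (λ σ n i → σ :* i :+ (n :- σ) :* i := n :* i) refl σ# n# (n# ⁻¹)) (⁻¹-inverseʳ n≉0)

    0≤s : 0# ≤ s
    0≤s = *-nonNegative (0≤fromℕ (Digraph.σ D)) 0≤n⁻¹

    -- The numerator `n - σ` counts the vertices without a loop, so it is a sum of indicators.
    0≤t : 0# ≤ t
    0≤t = *-nonNegative (≤-respʳ-≈ (sum-indicator-not (λ v → Digraph.arc D v v)) (0≤sum (λ v → 0≤indicator (not (Digraph.arc D v v))))) 0≤n⁻¹

    -- `sum-diagonal-≤` applied to the non-arcs: each row has `n - r` of them, so at most
    -- `n (n - r)` vertices lack a loop. This fixes the sign of the energy summand at the root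
    -- `n - δ - r`.
    t≤n-r : t ≤ n# - ρ
    t≤n-r = ≤-respʳ-≈ (/-cancelʳ (n# - ρ) n≉0) (*-monoˡ-≤ (n# ⁻¹) 0≤n⁻¹
      (≤-respˡ-≈ (sum-indicator-not (λ v → Digraph.arc D v v))
        (sum-diagonal-≤ (λ v w → not (Digraph.arc D v w)) (n# - ρ)
          (λ v → trans (sum-indicator-not (Digraph.arc D v)) (+-congˡ (-‿cong (reflexive (≡.cong fromℕ (proj₁ (regular v))))))))))

    -- The loops of the complement are counted by the trace of J - δ I - A, which is `n - δ n - σ`.
    σ/n-complement : σ/n (complement D) ≈ t - d
    σ/n-complement = begin
      fromℕ (Digraph.σ (complement D)) / n#
        ≈⟨ *-congʳ (sum-indicator (λ v → Digraph.arc (complement D) v v)) ⟨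
      sum (λ v → adjacency (complement D) v v) / n#
        ≈⟨ *-congʳ (sum-cong-≋ {n = suc m} (λ v → trans (adjacency-complement D v v) (trans (+-congʳ (+-congˡ (-‿cong (*-congˡ (identity-diagonal v)))))
             (solve 2 (λ d a → :1 :- d :* :1 :- a := (:1 :- d) :+ :- :1 :* a) refl d (adjacency D v v))))) ⟩
      sum {suc m} (λ v → (1# - d) + - 1# * adjacency D v v) / n#
        ≈⟨ *-congʳ (∑-distrib-+ {suc m} (λ _ → 1# - d) (λ v → - 1# * adjacency D v v)) ⟩
      (sum {suc m} (λ _ → 1# - d) + sum {suc m} (λ v → - 1# * adjacency D v v)) / n#
        ≈⟨ *-congʳ (+-cong (sum-const (suc m) (1# - d)) (trans (sym (*-distribˡ-sum (- 1#) (λ v → adjacency D v v)))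
             (*-congˡ (sum-indicator (λ v → Digraph.arc D v v))))) ⟩
      ((1# - d) * n# + - 1# * σ#) / n#
        ≈⟨ solve 4 (λ d n σ i → ((:1 :- d) :* n :+ :- :1 :* σ) :* i := (n :- σ) :* i :- d :* (n :* i)) refl d n# σ# (n# ⁻¹) ⟩
      t - d * (n# * n# ⁻¹)
        ≈⟨ +-congˡ (-‿cong (trans (*-congˡ (⁻¹-inverseʳ n≉0)) (*-identityʳ d))) ⟩
      t - d ∎

    -- `spectrum-sum` for the summand `φ` of the energy of the complement. In it the `δ` of each
    -- root cancels against the `δ` of `σ/n-complement`; `ρ + t` and `n# - ρ - t` are the values of
    -- `φ` at the two extra roots.
    energy-complement : (ev ev′ : Vector ℂ (suc m)) →
      IsDigraphSpectrum D ev → IsDigraphSpectrum (complement D) ev′ →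
      (ρ + t) + energy (complement D) ev′ ≈ (n# - ρ - t) + sum (λ i → abs (re (ev i) + t))
    energy-complement ev ev′ spectrum spectrum′ = begin
      (ρ + t) + energy (complement D) ev′
        ≈⟨ +-cong (sym φ-r) (sum-cong-≋ {n = suc m} (λ i → abs-cong (+-congˡ {x = re (ev′ i)} (-‿cong σ/n-complement)))) ⟩
      φ (- (d + ρ)) + sum (λ i → φ (re (ev′ i)))
        ≈⟨ spectrum-sum D regular ev ev′ spectrum spectrum′ φ (λ eq → abs-cong (+-congʳ eq)) ⟩
      φ (n# - (d + ρ)) + sum (λ i → φ (- (d + re (ev i))))
        ≈⟨ +-cong φ-n-r (sum-cong-≋ {n = suc m} (λ i → φ-neg (re (ev i)))) ⟩
      (n# - ρ - t) + sum (λ i → abs (re (ev i) + t)) ∎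
      where
      φ : Carrier → Carrier
      φ x = abs (x - (t - d))
      φ-neg : ∀ x → φ (- (d + x)) ≈ abs (x + t)
      φ-neg x = trans (abs-cong (solve 3 (λ d x t → :- (d :+ x) :- (t :- d) := :- (x :+ t)) refl d x t)) (abs-neg (x + t))
      φ-r : φ (- (d + ρ)) ≈ ρ + t
      φ-r = trans (φ-neg ρ) (abs-nonNegative (0≤+ (0≤fromℕ r) 0≤t))
      φ-n-r : φ (n# - (d + ρ)) ≈ n# - ρ - t
      φ-n-r = trans (abs-cong (solve 4 (λ n d r t → n :- (d :+ r) :- (t :- d) := n :- r :- t) refl n# d ρ t)) (abs-nonNegative (≤⇒0≤ t≤n-r))

  card≈sum : (S : Subset n) → card S ≈ sum (indicator ∘ lookup S)
  card≈sum S = sym (trans (sum-indicator (lookup S)) (reflexive (≡.cong card (Vec.tabulate∘lookup S))))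

  card-∪ : (A B : Subset n) → (∀ i → lookup A i ≡ true → lookup B i ≡ true → ⊥) →
           card (A ∪ B) ≈ card A + card B
  card-∪ A B disjoint = begin
    card (A ∪ B)                                                ≈⟨ card≈sum (A ∪ B) ⟩
    sum (indicator ∘ lookup (A ∪ B))                            ≈⟨ sum-cong-≋ (λ i → trans (reflexive (≡.cong indicator (Vec.lookup-zipWith _∨_ i A B))) (indicator-∨ _ _ (disjoint i))) ⟩
    sum (λ i → indicator (lookup A i) + indicator (lookup B i)) ≈⟨ ∑-distrib-+ (indicator ∘ lookup A) (indicator ∘ lookup B) ⟩
    sum (indicator ∘ lookup A) + sum (indicator ∘ lookup B)     ≈⟨ +-cong (card≈sum A) (card≈sum B) ⟨
    card A + card B                                             ∎
    where
    indicator-∨ : ∀ a b → (a ≡ true → b ≡ true → ⊥) → indicator (a ∨ b) ≈ indicator a + indicator b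
    indicator-∨ true  true  disjoint = ⊥-elim (disjoint ≡.refl ≡.refl)
    indicator-∨ true  false _        = sym (+-identityʳ 1#)
    indicator-∨ false b     _        = sym (+-identityˡ _)

  -- The linear pieces of x ↦ ∣x − s∣ + ∣x + t∣; the Booleans are the
  -- memberships of an index in S₁ and in the set of the lower indices.
  data Position (s t x : Carrier) : Bool → Bool → Set ℓ₂ where
    upper  : s ≤ x → Position s t x true false
    middle : x ≤ s → - t ≤ x → Position s t x false false
    lower  : x ≤ s → x ≤ - t → Position s t x false true

  module _ (s t : Carrier) (0≤s : 0# ≤ s) (0≤t : 0# ≤ t) (s+t≈1 : s + t ≈ 1#) where

    -- The constants come from `s + t ≈ 1#`: the upper piece is `2x + t - s` with `t - s = 1 - 2s`,
    -- the middle one is `s + t = 1`, and the lower one is `- 2x + s - t` with `s - t = 1 + 2s - 2`.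
    -- On the outer pieces the sign of `x` is known from `0 ≤ s` and `0 ≤ t`, so `2x` and `- 2x`
    -- become `2∣x∣`; the Booleans merge the three cases into one summable formula.
    position-sum : ∀ {x u l} → Position s t x u l →
      abs (x - s) + abs (x + t) ≈
      1# + fromℕ 2 * (if u ∨ l then abs x else 0#) + (fromℕ 2 * s * (indicator l - indicator u) - fromℕ 2 * indicator l)
    position-sum {x} (upper s≤x) = begin
      abs (x - s) + abs (x + t)
        ≈⟨ +-cong (abs-nonNegative (≤⇒0≤ s≤x)) (abs-nonNegative (0≤+ 0≤x 0≤t)) ⟩
      (x - s) + (x + t)
        ≈⟨ solve 3 (λ s t x → (x :- s) :+ (x :+ t) := (s :+ t) :+ :2 :* x :+ (:2 :* s :* (:0 :- :1) :- :2 :* :0)) refl s t x ⟩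
      (s + t) + fromℕ 2 * x + (fromℕ 2 * s * (0# - 1#) - fromℕ 2 * 0#)
        ≈⟨ +-congʳ (+-cong s+t≈1 (*-congˡ (sym (abs-nonNegative 0≤x)))) ⟩
      1# + fromℕ 2 * abs x + (fromℕ 2 * s * (0# - 1#) - fromℕ 2 * 0#) ∎
      where
      0≤x : 0# ≤ x
      0≤x = ≤-trans 0≤s s≤x
    position-sum {x} (middle x≤s -t≤x) = begin
      abs (x - s) + abs (x + t)
        ≈⟨ +-cong (abs-nonPositive (x≤s⇒x-s≤0 x≤s)) (abs-nonNegative (-t≤x⇒0≤x+t -t≤x)) ⟩
      - (x - s) + (x + t)
        ≈⟨ solve 3 (λ s t x → :- (x :- s) :+ (x :+ t) := (s :+ t) :+ :2 :* :0 :+ (:2 :* s :* (:0 :- :0) :- :2 :* :0)) refl s t x ⟩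
      (s + t) + fromℕ 2 * 0# + (fromℕ 2 * s * (0# - 0#) - fromℕ 2 * 0#)
        ≈⟨ +-congʳ (+-congʳ s+t≈1) ⟩
      1# + fromℕ 2 * 0# + (fromℕ 2 * s * (0# - 0#) - fromℕ 2 * 0#) ∎
    position-sum {x} (lower x≤s x≤-t) = begin
      abs (x - s) + abs (x + t)
        ≈⟨ +-cong (abs-nonPositive (x≤s⇒x-s≤0 x≤s)) (abs-nonPositive (x≤-t⇒x+t≤0 x≤-t)) ⟩
      - (x - s) - (x + t)
        ≈⟨ solve 3 (λ s t x → :- (x :- s) :- (x :+ t) := (s :+ t) :+ :2 :* :- x :+ (:2 :* s :* (:1 :- :0) :- :2 :* (s :+ t))) refl s t x ⟩
      (s + t) + fromℕ 2 * - x + (fromℕ 2 * s * (1# - 0#) - fromℕ 2 * (s + t))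
        ≈⟨ +-cong (+-cong s+t≈1 (*-congˡ (sym (abs-nonPositive x≤0)))) (+-congˡ (-‿cong (*-congˡ s+t≈1))) ⟩
      1# + fromℕ 2 * abs x + (fromℕ 2 * s * (1# - 0#) - fromℕ 2 * 1#) ∎
      where
      x≤0 : x ≤ 0#
      x≤0 = ≤-trans x≤-t (≤-respʳ-≈ -0#≈0# (neg-mono-≤ 0≤t))

    positions-sum : (x : Vector Carrier n) (U L : Subset n) →
      (∀ i → Position s t (x i) (lookup U i) (lookup L i)) →
      sum (λ i → abs (x i - s) + abs (x i + t)) ≈
      fromℕ n + fromℕ 2 * sumOver (U ∪ L) (λ i → abs (x i)) + (fromℕ 2 * s * (card L - card U) - fromℕ 2 * card L)
    positions-sum {n} x U L position = begin
      sum (λ i → abs (x i - s) + abs (x i + t))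
        ≈⟨ sum-cong-≋ (λ i → position-sum (position i)) ⟩
      sum (λ i → 1# + two * a i + (two * s * (l i - u i) - two * l i))
        ≈⟨ sum-linear n a l u ⟩
      fromℕ n + two * sum a + (two * s * (sum l - sum u) - two * sum l)
        ≈⟨ +-cong (+-congˡ (*-congˡ (sum-cong-≋ (λ i → reflexive (≡.cong (λ b → if b then abs (x i) else 0#) (≡.sym (Vec.lookup-zipWith _∨_ i U L)))))))
             (+-cong (*-congˡ (+-cong (sym (card≈sum L)) (-‿cong (sym (card≈sum U))))) (-‿cong (*-congˡ (sym (card≈sum L))))) ⟩
      fromℕ n + two * sumOver (U ∪ L) (λ i → abs (x i)) + (two * s * (card L - card U) - two * card L) ∎
      where
      two : Carrier
      two = fromℕ 2
      a l u : Fin n → Carrier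
      a i = if lookup U i ∨ lookup L i then abs (x i) else 0#
      l i = indicator (lookup L i)
      u i = indicator (lookup U i)
      sum-linear : ∀ n (a l u : Fin n → Carrier) →
        sum (λ i → 1# + two * a i + (two * s * (l i - u i) - two * l i)) ≈
        fromℕ n + two * sum a + (two * s * (sum l - sum u) - two * sum l)
      sum-linear zero a l u = solve 2 (λ k s → :0 := :0 :+ k :* :0 :+ (k :* s :* (:0 :- :0) :- k :* :0)) refl two s
      sum-linear (suc n) a l u = trans (+-congˡ (sum-linear n (tail a) (tail l) (tail u)))
        (solve 9 (λ k s n a l u a′ l′ u′ →
          (:1 :+ k :* a :+ (k :* s :* (l :- u) :- k :* l)) :+ (n :+ k :* a′ :+ (k :* s :* (l′ :- u′) :- k :* l′)) :=
          (:1 :+ n) :+ k :* (a :+ a′) :+ (k :* s :* ((l :+ l′) :- (u :+ u′)) :- k :* (l :+ l′)))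
          refl two s (fromℕ n) (a zero) (l zero) (u zero) (sum (tail a)) (sum (tail l)) (sum (tail u)))

  -- Stated for any `U` and `L` that sort the indices into the three pieces, so that each range of
  -- `σ` only has to supply its own lower set.
  energy-sum : {m r : ℕ} (D : Digraph (suc m)) → Regular r D →
    (ev ev′ : Vector ℂ (suc m)) → IsDigraphSpectrum D ev → IsDigraphSpectrum (complement D) ev′ →
    let open IndexSets D ev using (s; t; x) in
    (U L : Subset (suc m)) → (∀ i → Position s t (x i) (lookup U i) (lookup L i)) →
    energy D ev + energy (complement D) ev′
      ≈ fromℕ 2 * (fromℕ (suc m) - fromℕ r - 1#)
        + fromℕ 2 * sumOver (U ∪ L) (λ i → abs (re (ev i)))
        + fromℕ 2 * fromℕ (Digraph.σ D) / fromℕ (suc m) * (card L - card U + 1#)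
        - fromℕ 2 * card L
  energy-sum {m} {r} D regular ev ev′ spectrum spectrum′ U L position = begin
    E + E′
      ≈⟨ solve 4 (λ e e′ ρ t → e :+ e′ := e :+ ((ρ :+ t) :+ e′) :- (ρ :+ t)) refl E E′ ρ t ⟩
    E + ((ρ + t) + E′) - (ρ + t)
      ≈⟨ +-congʳ (+-congˡ (energy-complement D regular ev ev′ spectrum spectrum′)) ⟩
    E + ((n# - ρ - t) + F) - (ρ + t)
      ≈⟨ solve 5 (λ e f n ρ t → e :+ ((n :- ρ :- t) :+ f) :- (ρ :+ t) := (e :+ f) :+ (n :- ρ :- ρ) :- :2 :* t) refl E F n# ρ t ⟩
    (E + F) + (n# - ρ - ρ) - fromℕ 2 * t
      -- Writing `- 2t` as `- 2 + 2s` yields both the `- 1` in `2 (n - r - 1)` and the `+ 1` beside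
      -- `card L - card U`.
      ≈⟨ +-cong (+-congʳ (trans (sym (∑-distrib-+ (λ i → abs (x i - s)) (λ i → abs (x i + t))))
           (positions-sum s t (0≤s D regular) (0≤t D regular) (s+t≈1 D regular) x U L position))) (-‿cong (*-congˡ t≈1-s)) ⟩
    (n# + fromℕ 2 * A + (fromℕ 2 * s * (l - u) - fromℕ 2 * l)) + (n# - ρ - ρ) - fromℕ 2 * (1# - s)
      ≈⟨ solve 7 (λ n ρ σ i a l u →
           (n :+ :2 :* a :+ (:2 :* (σ :* i) :* (l :- u) :- :2 :* l)) :+ (n :- ρ :- ρ) :- :2 :* (:1 :- σ :* i) :=
           :2 :* (n :- ρ :- :1) :+ :2 :* a :+ :2 :* σ :* i :* (l :- u :+ :1) :- :2 :* l)
           refl n# ρ (fromℕ (Digraph.σ D)) (n# ⁻¹) A l u ⟩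
    fromℕ 2 * (n# - ρ - 1#) + fromℕ 2 * A + fromℕ 2 * fromℕ (Digraph.σ D) / n# * (l - u + 1#) - fromℕ 2 * l ∎
    where
    open IndexSets D ev using (s; t; x)
    E E′ F A l u n# ρ : Carrier
    E = energy D ev
    E′ = energy (complement D) ev′
    F = sum (λ i → abs (x i + t))
    A = sumOver (U ∪ L) (λ i → abs (re (ev i)))
    l = card L
    u = card U
    n# = fromℕ (suc m)
    ρ = fromℕ r
    t≈1-s : t ≈ 1# - s
    t≈1-s = trans (solve 2 (λ s t → t := s :+ t :- s) refl s t) (+-congʳ (s+t≈1 D regular))

  lookup-select : {P : Fin n → Set ℓ} (P? : ∀ i → Dec (P i)) → ∀ i → lookup (select P?) i ≡ does (P? i)
  lookup-select P? i = Vec.lookup∘tabulate (does ∘ P?) i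

  lookup-select-true : {P : Fin n → Set ℓ} (P? : ∀ i → Dec (P i)) → ∀ {i} → P i → lookup (select P?) i ≡ true
  lookup-select-true P? {i} p = ≡.trans (lookup-select P? i) (dec-true (P? i) p)

  lookup-select-false : {P : Fin n → Set ℓ} (P? : ∀ i → Dec (P i)) → ∀ {i} → ¬ P i → lookup (select P?) i ≡ false
  lookup-select-false P? {i} ¬p = ≡.trans (lookup-select P? i) (dec-false (P? i) ¬p)

-- The index sets as ranges of the real parts.

module Classification {c ℓ₁ ℓ₂ : Level} (ℝ : Reals c ℓ₁ ℓ₂) where
  open Spectral ℝ hiding (zero)
  open OrderedField ℝ
  open EnergySum ℝ
  open RingSolver commutativeRing

  /2*2 : ∀ x → x / fromℕ 2 * fromℕ 2 ≈ x
  /2*2 x = trans (solve 3 (λ x i k → x :* i :* k := x :* k :* i) refl x (fromℕ 2 ⁻¹) (fromℕ 2)) (/-cancelʳ x (fromℕ-suc≉0 1))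

  x/2≤y⇒x-y≤y : ∀ {x y} → x / fromℕ 2 ≤ y → x - y ≤ y
  x/2≤y⇒x-y≤y {x} {y} x/2≤y = 0≤⇒≤ (solve 2 (λ x y → y :- (x :- y) := y :* :2 :- x) refl x y)
    (≤⇒0≤ (≤-respˡ-≈ (/2*2 x) (*-monoˡ-≤ (fromℕ 2) (0≤fromℕ 2) x/2≤y)))

  y≤x/2⇒y≤x-y : ∀ {x y} → y ≤ x / fromℕ 2 → y ≤ x - y
  y≤x/2⇒y≤x-y {x} {y} y≤x/2 = 0≤⇒≤ (solve 2 (λ x y → (x :- y) :- y := x :- y :* :2) refl x y)
    (≤⇒0≤ (≤-respʳ-≈ (/2*2 x) (*-monoˡ-≤ (fromℕ 2) (0≤fromℕ 2) y≤x/2)))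

  module _ {m r : ℕ} (D : Digraph (suc m)) (regular : Regular r D) (ev : Vector ℂ (suc m)) where
    open IndexSets D ev

    private
      S₁? : ∀ i → Dec (s ≤ x i)
      S₁? i = s ≤? x i
      S₂⁻? : ∀ i → Dec (((- s < x i) × (x i < s)) × (x i + t ≤ 0#))
      S₂⁻? i = ((- s <? x i) ×-dec (x i <? s)) ×-dec (x i + t ≤? 0#)
      S₃⁺? : ∀ i → Dec ((x i ≤ - s) × (0# < x i + t))
      S₃⁺? i = (x i ≤? - s) ×-dec (0# <? x i + t)
      S₃⁻? : ∀ i → Dec ((x i ≤ - s) × (x i + t ≤ 0#))
      S₃⁻? i = (x i ≤? - s) ×-dec (x i + t ≤? 0#)

      ≮ : ∀ {y z} → z ≤ y → ¬ y < z
      ≮ z≤y (y≤z , y≉z) = y≉z (antisym y≤z z≤y)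

      -- Otherwise `1 = s + t ≤ y + t ≤ 0`. This keeps `S₁` apart from every set that asks for
      -- `x i + t ≤ 0#`.
      ¬upper∧lower : ∀ {y} → s ≤ y → ¬ y + t ≤ 0#
      ¬upper∧lower s≤y y+t≤0 = 1≰0 (≤-trans (≤-respˡ-≈ (s+t≈1 D regular) (+-monoˡ-≤ t s≤y)) y+t≤0)

      lookup-L : ∀ i {a b c} → lookup S₂⁻ i ≡ a → lookup S₃⁺ i ≡ b → lookup S₃⁻ i ≡ c →
                 lookup (S₂⁻ ∪ S₃) i ≡ a ∨ (b ∨ c)
      lookup-L i ≡.refl ≡.refl ≡.refl =
        ≡.trans (Vec.lookup-zipWith _∨_ i S₂⁻ S₃) (≡.cong (lookup S₂⁻ i ∨_) (Vec.lookup-zipWith _∨_ i S₃⁺ S₃⁻))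

      position : ∀ i {U L : Subset (suc m)} {u l} → lookup U i ≡ u → lookup L i ≡ l →
                 Position s t (x i) u l → Position s t (x i) (lookup U i) (lookup L i)
      position i ≡.refl ≡.refl p = p

    n/2≤σ⇒t≤s : fromℕ (suc m) / fromℕ 2 ≤ fromℕ (Digraph.σ D) → t ≤ s
    n/2≤σ⇒t≤s n/2≤σ = *-monoˡ-≤ _ (0≤n⁻¹ D regular) (x/2≤y⇒x-y≤y n/2≤σ)

    σ≤n/2⇒s≤t : fromℕ (Digraph.σ D) ≤ fromℕ (suc m) / fromℕ 2 → s ≤ t
    σ≤n/2⇒s≤t σ≤n/2 = *-monoˡ-≤ _ (0≤n⁻¹ D regular) (y≤x/2⇒y≤x-y σ≤n/2)

    -- Here `- s ≤ - t`, so the range `x ≤ - t` is cut at `- s` into `S₃⁻` and, above it, `S₂⁻`.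
    -- Since `x ≤ - s` already forces `x + t ≤ 0`, `S₃⁺` is empty and `S₃` adds nothing beyond
    -- `S₃⁻`.
    positions-manyLoops : t ≤ s → ∀ i → Position s t (x i) (lookup S₁ i) (lookup (S₂⁻ ∪ S₃) i)
    positions-manyLoops t≤s i with s ≤? x i | x i + t ≤? 0# | x i ≤? - s
    ... | yes s≤x | _ | _ = position i {S₁} {S₂⁻ ∪ S₃} (lookup-select-true S₁? s≤x)
      (lookup-L i (lookup-select-false S₂⁻? (¬upper∧lower s≤x ∘ proj₂))
                  (lookup-select-false S₃⁺? (λ (x≤-s , _) → ¬upper∧lower s≤x (x≤-t⇒x+t≤0 (≤-trans x≤-s (neg-mono-≤ t≤s)))))
                  (lookup-select-false S₃⁻? (¬upper∧lower s≤x ∘ proj₂)))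
      (upper s≤x)
    ... | no s≰x | yes x+t≤0 | yes x≤-s = position i {S₁} {S₂⁻ ∪ S₃} (lookup-select-false S₁? s≰x)
      (lookup-L i (lookup-select-false S₂⁻? (λ ((-s<x , _) , _) → ≮ x≤-s -s<x))
                  (lookup-select-false S₃⁺? (λ (_ , 0<x+t) → ≮ x+t≤0 0<x+t))
                  (lookup-select-true S₃⁻? (x≤-s , x+t≤0)))
      (lower (proj₁ (≰⇒> s≰x)) (x+t≤0⇒x≤-t x+t≤0))
    ... | no s≰x | yes x+t≤0 | no x≰-s = position i {S₁} {S₂⁻ ∪ S₃} (lookup-select-false S₁? s≰x)
      (lookup-L i (lookup-select-true S₂⁻? ((≰⇒> x≰-s , ≰⇒> s≰x) , x+t≤0))
                  (lookup-select-false S₃⁺? (x≰-s ∘ proj₁))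
                  (lookup-select-false S₃⁻? (x≰-s ∘ proj₁)))
      (lower (proj₁ (≰⇒> s≰x)) (x+t≤0⇒x≤-t x+t≤0))
    ... | no s≰x | no x+t≰0 | _ = position i {S₁} {S₂⁻ ∪ S₃} (lookup-select-false S₁? s≰x)
      (lookup-L i (lookup-select-false S₂⁻? (x+t≰0 ∘ proj₂))
                  (lookup-select-false S₃⁺? (λ (x≤-s , _) → x+t≰0 (x≤-t⇒x+t≤0 (≤-trans x≤-s (neg-mono-≤ t≤s)))))
                  (lookup-select-false S₃⁻? (x+t≰0 ∘ proj₂)))
      (middle (proj₁ (≰⇒> s≰x)) (0≤x+t⇒-t≤x (proj₁ (≰⇒> x+t≰0))))

    -- Here `- t ≤ - s`, so `x + t ≤ 0` already implies `x ≤ - s`, and `S₃⁻` is the whole range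
    -- `x ≤ - t`.
    positions-fewLoops : s ≤ t → ∀ i → Position s t (x i) (lookup S₁ i) (lookup S₃⁻ i)
    positions-fewLoops s≤t i with s ≤? x i | x i + t ≤? 0#
    ... | yes s≤x | _ = position i {S₁} {S₃⁻} (lookup-select-true S₁? s≤x)
      (lookup-select-false S₃⁻? (¬upper∧lower s≤x ∘ proj₂)) (upper s≤x)
    ... | no s≰x | yes x+t≤0 = position i {S₁} {S₃⁻} (lookup-select-false S₁? s≰x)
      (lookup-select-true S₃⁻? (≤-trans (x+t≤0⇒x≤-t x+t≤0) (neg-mono-≤ s≤t) , x+t≤0))
      (lower (proj₁ (≰⇒> s≰x)) (x+t≤0⇒x≤-t x+t≤0))
    ... | no s≰x | no x+t≰0 = position i {S₁} {S₃⁻} (lookup-select-false S₁? s≰x)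
      (lookup-select-false S₃⁻? (x+t≰0 ∘ proj₂))
      (middle (proj₁ (≰⇒> s≰x)) (0≤x+t⇒-t≤x (proj₁ (≰⇒> x+t≰0))))

    -- The bound `- s` separates the two sets: it lies strictly below `x` on `S₂⁻` and not below it
    -- on `S₃`.
    card-S₂⁻∪S₃ : card (S₂⁻ ∪ S₃) ≈ card S₂⁻ + card S₃
    card-S₂⁻∪S₃ = card-∪ S₂⁻ S₃ disjoint
      where
      disjoint : ∀ i → lookup S₂⁻ i ≡ true → lookup S₃ i ≡ true → ⊥
      disjoint i i∈S₂⁻ i∈S₃ with x i ≤? - s
      ... | yes x≤-s = contradiction (≡.trans (≡.sym i∈S₂⁻) (lookup-select-false S₂⁻? (λ ((-s<x , _) , _) → ≮ x≤-s -s<x))) λ ()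
      ... | no x≰-s  = contradiction (≡.trans (≡.sym i∈S₃) (≡.trans (Vec.lookup-zipWith _∨_ i S₃⁺ S₃⁻)
        (≡.cong₂ _∨_ (lookup-select-false S₃⁺? (x≰-s ∘ proj₁)) (lookup-select-false S₃⁻? (x≰-s ∘ proj₁))))) λ ()

theorem5p13 :
  {c ℓ₁ ℓ₂ : Level} (ℝ : Reals c ℓ₁ ℓ₂) →
  let open Spectral ℝ hiding (zero) in
  (m : ℕ) → let n = suc m in
  (r : ℕ) (D : Digraph n) → Regular r D →
  (ev : Vector ℂ n) → IsDigraphSpectrum D ev → ev zero ≈ℂ fromℝ (fromℕ r) →
  (ev′ : Vector ℂ n) → IsDigraphSpectrum (complement D) ev′ →
  let open IndexSets D ev
      σ = Digraph.σ D
  in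
  ( fromℕ n / fromℕ 2 ≤ fromℕ σ → fromℕ σ ≤ fromℕ n →
    energy D ev + energy (complement D) ev′
      ≈ fromℕ 2 * (fromℕ n - fromℕ r - 1#)
        + fromℕ 2 * sumOver (S₁ ∪ S₂⁻ ∪ S₃) (λ i → abs (re (ev i)))
        + fromℕ 2 * fromℕ σ / fromℕ n
          * (card S₂⁻ + card S₃ - card S₁ + 1#)
        - fromℕ 2 * (card S₂⁻ + card S₃) )
  ×
  ( 0# ≤ fromℕ σ → fromℕ σ < fromℕ n / fromℕ 2 →
    energy D ev + energy (complement D) ev′
      ≈ fromℕ 2 * (fromℕ n - fromℕ r - 1#)
        + fromℕ 2 * sumOver (S₁ ∪ S₃⁻) (λ i → abs (re (ev i)))
        + fromℕ 2 * fromℕ σ / fromℕ n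
          * (card S₃⁻ - card S₁ + 1#)
        - fromℕ 2 * card S₃⁻ )
theorem5p13 ℝ m r D regular ev spectrum _ ev′ spectrum′ = manyLoops , fewLoops
  where
  open Spectral ℝ hiding (zero)
  open EnergySum ℝ
  open Classification ℝ
  open IndexSets D ev

  manyLoops : fromℕ (suc m) / fromℕ 2 ≤ fromℕ (Digraph.σ D) → _ → _
  manyLoops n/2≤σ _ = trans
    (energy-sum D regular ev ev′ spectrum spectrum′ S₁ (S₂⁻ ∪ S₃)
      (positions-manyLoops D regular ev (n/2≤σ⇒t≤s D regular ev n/2≤σ)))
    -- The cardinality of the lower set occurs twice, beside `card S₁` and in the last summand, and
    -- is split in both places.
    (+-cong (+-congˡ (*-congˡ (+-congʳ (+-congʳ card≈)))) (-‿cong (*-congˡ card≈)))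
    where
    card≈ : card (S₂⁻ ∪ S₃) ≈ card S₂⁻ + card S₃
    card≈ = card-S₂⁻∪S₃ D regular ev

  fewLoops : _ → fromℕ (Digraph.σ D) < fromℕ (suc m) / fromℕ 2 → _
  fewLoops _ σ<n/2 = energy-sum D regular ev ev′ spectrum spectrum′ S₁ S₃⁻
    (positions-fewLoops D regular ev (σ≤n/2⇒s≤t D regular ev (proj₁ σ<n/2)))
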